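{- Let $q$ be an odd prime power, let $\zeta$ be a symplectic polarity of $\mathrm{PG}(3,q)$ with associated symplectic graph $Sp(4,q)$, and let $S$ be a special spread of $\mathrm{PG}(3,q)$ with respect to $\zeta$. Partition the vertices of $Sp(4,q)$ into two parts $V_1$ and $V_2$ of equal size such that, for every subgraph $K_{q+1,q+1}$ associated with $S$, one of its two bipartition parts is contained in $V_1$ and the other is contained in $V_2$. Let $\Gamma'_{q,S}$ be the graph obtained from $Sp(4,q)$ by replacing the subgraphs induced by $V_1$ and by $V_2$ by their complements (keeping the edges between $V_1$ and $V_2$ unchanged). Then $\Gamma'_{q,S}$ is a divisible design graph with parameters $$(v,k,\lambda_1,\lambda_2,m,n)=\Big((q^2+1)(q+1),\ \tfrac{q^3+q^2+3q+1}{2},\ \tfrac{q^3-q^2+3q+1}{2},\ q^2+q,\ 2,\ \tfrac{(q^2+1)(q+1)}{2}\Big).$$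
   Context: A $k$-regular graph on $v$ vertices is a divisible design graph with parameters $(v,k,\lambda_1,\lambda_2,m,n)$ if its vertex set can be partitioned into $m$ classes of size $n$ such that any two distinct vertices from the same class have exactly $\lambda_1$ common neighbours and any two vertices from different classes have exactly $\lambda_2$ common neighbours. A symplectic polarity $\zeta$ of $\mathrm{PG}(3,q)$ is a polarity with $x\in x^\zeta$ for every point $x$. The graph $Sp(4,q)$ has the points of $\mathrm{PG}(3,q)$ as vertices, two distinct points $x,y$ being adjacent iff $y\in x^\zeta$ (i.e. $x$ and $y$ are orthogonal). A line $L$ is totally isotropic if $L^\zeta=L$. A spread is a set of lines of $\mathrm{PG}(3,q)$ partitioning its point set. For $q$ odd, a special spread is a spread $S$ consisting of lines that are not totally isotropic such that for every $\ell\in S$ there is a uniquely determined line $\ell'\in S$ such that any point of $\ell$ is orthogonal to any point of $\ell'$ (that is, $\ell'=\ell^\zeta$). For paired lines $\ell,\ell'\in S$, the set $\ell\cup\ell'$ induces in $Sp(4,q)$ a complete bipartite graph $K_{q+1,q+1}$ with parts $\ell$ and $\ell'$; these are the subgraphs $K_{q+1,q+1}$ associated with $S$, and their vertex sets partition the vertex set of $Sp(4,q)$. -}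

module Defs where

open import Algebra.Apartness.Bundles using (HeytingField; HeytingCommutativeRing)
open import Algebra.Bundles using (CommutativeRing)
open import Data.Fin.Base using (Fin)
open import Data.Nat.Base as ℕ using (ℕ)
open import Data.Nat.Divisibility using (_∤_)
open import Data.Nat.Primality using (Prime)
open import Data.Product using (Σ; ∃; ∃!; ∃₂; _×_; _,_; proj₁; proj₂; swap)
open import Data.Sum.Base using (_⊎_; inj₁; inj₂)
open import Data.Vec.Functional using (Vector)
open import Function.Base using (_∘_)
open import Function.Bundles using (Func; Inverse)
open import Level using (Level; _⊔_) renaming (suc to lsuc)
open import Relation.Binary.Bundles using (Setoid)
import Relation.Binary.Construct.On as On
open import Relation.Binary.Definitions using (Symmetric; _Respects_)
open import Relation.Binary.PropositionalEquality.Core using (_≡_)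
import Relation.Binary.PropositionalEquality.Properties as ≡
open import Relation.Nullary.Negation.Core using (¬_)
open import Relation.Unary using (Pred; Decidable)
import Data.Vec.Functional.Relation.Binary.Equality.Setoid as VecEq
import Algebra.Properties.Monoid.Sum as MonoidSum

IsOddPrimePower : ℕ → Set
IsOddPrimePower q = 2 ∤ q × ∃₂ λ p e → Prime p × 1 ℕ.≤ e × q ≡ p ℕ.^ e

-- Cardinalities count elements up to the setoid equality.

HasSize : ∀ {a ℓ} → Setoid a ℓ → ℕ → Set (a ⊔ ℓ)
HasSize A n = Inverse A (≡.setoid (Fin n))

subsetoid : ∀ {a ℓ p} (A : Setoid a ℓ) → Pred (Setoid.Carrier A) p → Setoid (a ⊔ p) ℓ
subsetoid A P = On.setoid A (proj₁ {B = P})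

record IsBipartition {a ℓ p} (A : Setoid a ℓ) (P Q : Pred (Setoid.Carrier A) p)
                     : Set (a ⊔ ℓ ⊔ p) where
  open Setoid A
  field
    respˡ    : P Respects _≈_
    respʳ    : Q Respects _≈_
    cover    : ∀ x → P x ⊎ Q x
    disjoint : ∀ x → ¬ (P x × Q x)

record Graph (a ℓ e : Level) : Set (lsuc (a ⊔ ℓ ⊔ e)) where
  field
    vertices : Setoid a ℓ
  open Setoid vertices public renaming (Carrier to Vertex)
  infix 4 _~_
  field
    _~_      : Vertex → Vertex → Set e
    ~-resp   : ∀ {x x′ y y′} → x ≈ x′ → y ≈ y′ → x ~ y → x′ ~ y′
    ~-sym    : Symmetric _~_
    ~-irrefl : ∀ {x y} → x ≈ y → ¬ (x ~ y)

-- The partition into m classes of size n is encoded by the map sending a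
-- vertex to the index of its class.

record IsDivisibleDesignGraph {a ℓ e} (Γ : Graph a ℓ e) (v k λ₁ λ₂ m n : ℕ)
                              : Set (a ⊔ ℓ ⊔ e) where
  open Graph Γ
  field
    order     : HasSize vertices v
    regular   : ∀ x → HasSize (subsetoid vertices (x ~_)) k
    partition : Func vertices (≡.setoid (Fin m))

  class : Vertex → Fin m
  class = Func.to partition

  field
    classSize : ∀ i → HasSize (subsetoid vertices (λ x → class x ≡ i)) n
    sameClass : ∀ x y → ¬ (x ≈ y) → class x ≡ class y →
                HasSize (subsetoid vertices (λ z → x ~ z × y ~ z)) λ₁
    diffClass : ∀ x y → ¬ (class x ≡ class y) →
                HasSize (subsetoid vertices (λ z → x ~ z × y ~ z)) λ₂

-- Replace the subgraph induced on P by its complement.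

complementWithin : ∀ {a ℓ e p} (Γ : Graph a ℓ e) (P : Pred (Graph.Vertex Γ) p) →
                   P Respects (Graph._≈_ Γ) → Graph a ℓ (ℓ ⊔ e ⊔ p)
complementWithin Γ P resp = record
  { vertices = vertices
  ; _~_      = λ x y → ((P x × P y) × ¬ (x ≈ y) × ¬ (x ~ y))
                     ⊎ (¬ (P x × P y) × x ~ y)
  ; ~-resp   = λ x≈ y≈ → λ
      { (inj₁ ((px , py) , x≉y , x≁y)) → inj₁
          ( (resp x≈ px , resp y≈ py)
          , (λ e → x≉y (trans x≈ (trans e (sym y≈))))
          , (λ e → x≁y (~-resp (sym x≈) (sym y≈) e)))
      ; (inj₂ (¬pp , x~y)) → inj₂
          ( (λ (px , py) → ¬pp (resp (sym x≈) px , resp (sym y≈) py))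
          , ~-resp x≈ y≈ x~y) }
  ; ~-sym    = λ
      { (inj₁ (pp , x≉y , x≁y)) → inj₁ (swap pp , x≉y ∘ sym , x≁y ∘ ~-sym)
      ; (inj₂ (¬pp , x~y))      → inj₂ (¬pp ∘ swap , ~-sym x~y) }
  ; ~-irrefl = λ x≈y → λ
      { (inj₁ (_ , x≉y , _)) → x≉y x≈y
      ; (inj₂ (_ , x~y))     → ~-irrefl x≈y x~y }
  }
  where open Graph Γ

-- The field will be finite, so equality is decidable; tightness then gives
-- every nonzero scalar an inverse, as in the classical definition of a field.

module PG3 {c ℓ₁ ℓ₂} (F : HeytingField c ℓ₁ ℓ₂) where

  private
    commutativeRing : CommutativeRing c ℓ₁
    commutativeRing =
      HeytingCommutativeRing.commutativeRing (HeytingField.heytingCommutativeRing F)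

  open CommutativeRing commutativeRing public
    using (Carrier; _≈_; _+_; _*_; 0#; +-monoid)
    renaming (setoid to scalars)
  open VecEq scalars using (_≋_)
  open MonoidSum +-monoid using (sum)

  V : Set c
  V = Vector Carrier 4

  0ᵛ : V
  0ᵛ _ = 0#

  _+ᵛ_ : V → V → V
  (u +ᵛ w) j = u j + w j

  _*ᵛ_ : Carrier → V → V
  (a *ᵛ u) j = a * u j

  combination : ∀ {d} → Vector Carrier d → Vector V d → V
  combination a b j = sum (λ i → a i * b i j)

  -- Classically, decidability is no restriction; constructively, over a finite
  -- field, it holds for every subspace that is the span of finitely many vectors.

  record Subspace : Set (lsuc (c ⊔ ℓ₁)) where
    field
      Mem       : Pred V (c ⊔ ℓ₁)
      mem?      : Decidable Mem
      mem-resp  : Mem Respects _≋_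
      0-closed  : Mem 0ᵛ
      +-closed  : ∀ {u w} → Mem u → Mem w → Mem (u +ᵛ w)
      *-closed  : ∀ a {u} → Mem u → Mem (a *ᵛ u)

  open Subspace public using (Mem)

  infix 4 _⊑_ _≐_

  _⊑_ : Subspace → Subspace → Set (c ⊔ ℓ₁)
  U ⊑ W = ∀ {x} → Mem U x → Mem W x

  _≐_ : Subspace → Subspace → Set (c ⊔ ℓ₁)
  U ≐ W = U ⊑ W × W ⊑ U

  subspaces : Setoid (lsuc (c ⊔ ℓ₁)) (c ⊔ ℓ₁)
  subspaces = record
    { Carrier       = Subspace
    ; _≈_           = _≐_
    ; isEquivalence = record
      { refl  = (λ x → x) , (λ x → x)
      ; sym   = swap
      ; trans = λ (f , f′) (g , g′) → (λ x → g (f x)) , (λ x → f′ (g′ x))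
      }
    }

  record IsBasis {d} (b : Vector V d) (U : Subspace) : Set (c ⊔ ℓ₁) where
    field
      mem         : ∀ i → Mem U (b i)
      independent : ∀ a → combination a b ≋ 0ᵛ → ∀ i → a i ≈ 0#
      spanning    : ∀ {u} → Mem U u → ∃ λ a → u ≋ combination a b

  -- d is the vector space dimension, one more than the projective dimension.

  Flat : ℕ → Set (lsuc (c ⊔ ℓ₁))
  Flat d = Σ Subspace λ U → ∃ λ (b : Vector V d) → IsBasis b U

  ⟨_⟩ : ∀ {d} → Flat d → Subspace
  ⟨_⟩ = proj₁

  flats : ℕ → Setoid (lsuc (c ⊔ ℓ₁)) (c ⊔ ℓ₁)
  flats d = On.setoid subspaces (⟨_⟩ {d})

  Point Line : Set (lsuc (c ⊔ ℓ₁))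
  Point = Flat 1
  Line  = Flat 2

  infix 4 _≈ₚ_ _≈ₗ_ _on_

  _≈ₚ_ : Point → Point → Set (c ⊔ ℓ₁)
  _≈ₚ_ = Setoid._≈_ (flats 1)

  _≈ₗ_ : Line → Line → Set (c ⊔ ℓ₁)
  _≈ₗ_ = Setoid._≈_ (flats 2)

  _on_ : Point → Line → Set (c ⊔ ℓ₁)
  x on L = ⟨ x ⟩ ⊑ ⟨ L ⟩

  -- An inclusion-reversing involution of the lattice of all subspaces of F⁴,
  -- including the zero space and F⁴ itself.

  record Polarity : Set (lsuc (c ⊔ ℓ₁)) where
    field
      _^ζ        : Subspace → Subspace
      antitone   : ∀ {U W} → U ⊑ W → W ^ζ ⊑ U ^ζ
      involutive : ∀ U → (U ^ζ) ^ζ ≐ U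

  record SymplecticPolarity : Set (lsuc (c ⊔ ℓ₁)) where
    field
      polarity : Polarity
    open Polarity polarity public
    field
      symplectic : ∀ (x : Point) → ⟨ x ⟩ ⊑ ⟨ x ⟩ ^ζ

  module _ (ζ : SymplecticPolarity) where
    open SymplecticPolarity ζ

    Orthogonal : Point → Point → Set (c ⊔ ℓ₁)
    Orthogonal x y = ⟨ y ⟩ ⊑ ⟨ x ⟩ ^ζ

    Sp4 : Graph (lsuc (c ⊔ ℓ₁)) (c ⊔ ℓ₁) (c ⊔ ℓ₁)
    Sp4 = record
      { vertices = flats 1
      ; _~_      = λ x y → ¬ (x ≈ₚ y) × Orthogonal x y
      ; ~-resp   = λ {x} {x′} {y} {y′} x≈ y≈ (x≉y , x⊥y) →
          (λ e → x≉y (trans {x} {x′} {y} x≈ (trans {x′} {y′} {y} e (sym {y} {y′} y≈))))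
          , (λ v∈y′ → antitone {⟨ x′ ⟩} {⟨ x ⟩} (λ v → proj₂ x≈ v)
                        (x⊥y (proj₂ y≈ v∈y′)))
      ; ~-sym    = λ {x} {y} (x≉y , x⊥y) →
          (λ e → x≉y (sym {y} {x} e))
          , (λ v∈x → antitone {⟨ y ⟩} {⟨ x ⟩ ^ζ} x⊥y
                       (proj₂ (involutive ⟨ x ⟩) v∈x))
      ; ~-irrefl = λ x≈y (x≉y , _) → x≉y x≈y
      }
      where open Setoid (flats 1) using (sym; trans)

    TotallyIsotropic : Line → Set (c ⊔ ℓ₁)
    TotallyIsotropic L = ⟨ L ⟩ ^ζ ≐ ⟨ L ⟩

    OrthogonalLines : Line → Line → Set (lsuc (c ⊔ ℓ₁))
    OrthogonalLines L M = ∀ x y → x on L → y on M → Orthogonal x y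

    record IsSpread {s} (S : Pred Line s) : Set (lsuc (c ⊔ ℓ₁) ⊔ s) where
      field
        resp   : S Respects _≈ₗ_
        covers : ∀ x → ∃! _≈ₗ_ (λ L → S L × x on L)

    record IsSpecialSpread {s} (S : Pred Line s) : Set (lsuc (c ⊔ ℓ₁) ⊔ s) where
      field
        isSpread     : IsSpread S
        nonIsotropic : ∀ L → S L → ¬ TotallyIsotropic L
        paired       : ∀ L → S L → ∃! _≈ₗ_ (λ M → S M × OrthogonalLines L M)

    _⊆ᵖ_ : ∀ {p} → Line → Pred Point p → Set (lsuc (c ⊔ ℓ₁) ⊔ p)
    L ⊆ᵖ P = ∀ x → x on L → P x

    -- The parts of the associated complete bipartite subgraphs are the point
    -- sets of two paired lines of S.

    SeparatesParts : ∀ {s p} → Pred Line s → (V₁ V₂ : Pred Point p) →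
                     Set (lsuc (c ⊔ ℓ₁) ⊔ s ⊔ p)
    SeparatesParts S V₁ V₂ = ∀ L M → S L → S M → OrthogonalLines L M →
      (L ⊆ᵖ V₁ × M ⊆ᵖ V₂) ⊎ (L ⊆ᵖ V₂ × M ⊆ᵖ V₁)

    Γ′ : ∀ {p} {V₁ V₂ : Pred Point p} → IsBipartition (flats 1) V₁ V₂ →
         Graph (lsuc (c ⊔ ℓ₁)) (c ⊔ ℓ₁) (c ⊔ ℓ₁ ⊔ p)
    Γ′ {V₁ = V₁} {V₂} bip =
      complementWithin (complementWithin Sp4 V₁ respˡ) V₂ respʳ
      where open IsBipartition bip

{-# OPTIONS --safe #-}
module Submission where

-- Write x ⊥ for the polar plane of x, and V₁, V₂ for the two classes.  Two points
-- are adjacent in the new graph iff they are orthogonal and in different classes, or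
-- not orthogonal and in the same class.  Inclusion-exclusion therefore expresses all
-- parameters through |Vᵢ|, |x ⊥ ∩ Vᵢ| and |x ⊥ ∩ y ⊥|, and the unknown numbers
-- |x ⊥ ∩ y ⊥ ∩ Vᵢ| cancel.
--
-- No classification of polarities is needed: x ⊥ is a maximal proper subspace because
-- ⟨ x ⟩ is a minimal nonzero one, and a subspace not contained in x ⊥ meets it in a
-- 1/q fraction of its vectors.  A line of the spread S thus meets x ⊥ in one point or
-- lies in it.  Counting points of x ⊥ shows that the lines of S inside x ⊥ cover only
-- q + 1 points, so the partner of the line through x is the only one; it lies in the
-- other class, and hence |x ⊥ ∩ Vᵢ| = (q² + 1)/2 for the class Vᵢ of x.

open import Defs
open import Algebra.Apartness.Bundles using (HeytingField; HeytingCommutativeRing)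
import Algebra.Apartness.Properties.HeytingCommutativeRing as HeytingCommutativeRingProperties
open import Algebra.Bundles using (CommutativeRing)
import Algebra.Properties.CommutativeSemigroup as CommutativeSemigroupProperties
import Algebra.Properties.Ring as RingProperties
import Algebra.Properties.Semiring.Sum as SemiringSum
open import Data.Bool.Base using (if_then_else_)
open import Data.Fin.Base as Fin using (Fin; zero; suc)
import Data.Fin.Permutation as Permutation
import Data.Fin.Properties as Fin
open import Data.Nat as ℕ using (ℕ; zero; suc; _^_)
open import Data.Nat.DivMod using (_/_; m*n/n≡m)
import Data.Nat.Properties as ℕ
open import Data.Nat.Tactic.RingSolver using (solve-∀)
open import Data.Product using (∃; _×_; _,_; proj₁; proj₂)
open import Data.Sum.Base using (_⊎_; inj₁; inj₂)
open import Data.Unit.Base using (⊤)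
open import Data.Vec.Functional using (Vector)
import Data.Vec.Functional.Relation.Binary.Equality.Setoid as VecEq
open import Function.Base using (_∘_; case_of_)
open import Function.Bundles using (Inverse)
open import Function.Construct.Composition using () renaming (inverse to _⨾_)
open import Function.Construct.Symmetry using () renaming (inverse to flipᵢ)
open import Level using (Level; _⊔_)
open import Relation.Binary.Bundles using (Setoid)
open import Relation.Binary.Definitions using (_Respects_)
open import Relation.Binary.PropositionalEquality as ≡
  using (_≡_; _≢_; refl; sym; trans; cong; cong₂; subst)
import Relation.Binary.Reasoning.Setoid as SetoidReasoning
open import Relation.Nullary
  using (¬_; Dec; yes; no; does; contradiction; _×-dec_; _⊎-dec_; ¬?)
open import Relation.Nullary.Decidable using (map′; decidable-stable)
open import Relation.Unary using (Pred; Decidable)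

private module ∑ = SemiringSum ℕ.+-*-semiring

-- Counting in finite setoids

private
  variable
    a b ℓ ℓ′ p r : Level
    n m k : ℕ

-- Only `does` is inspected, so wrapping a decision in `map′` leaves its indicator definitionally
-- unchanged, and the indicator of a compound decision computes once its components are known.
⟦_⟧ : ∀ {P : Set p} → Dec P → ℕ
⟦ P? ⟧ = if does P? then 1 else 0

⟦⟧-cong : ∀ {P : Set p} {R : Set r} (P? : Dec P) (R? : Dec R) →
          (P → R) → (R → P) → ⟦ P? ⟧ ≡ ⟦ R? ⟧
⟦⟧-cong (yes _) (yes _) f g = refl
⟦⟧-cong (yes x) (no ¬y) f g = contradiction (f x) ¬y
⟦⟧-cong (no ¬x) (yes y) f g = contradiction (g y) ¬x
⟦⟧-cong (no _)  (no _)  f g = refl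

size-unique : {A : Setoid a ℓ} → HasSize A n → HasSize A m → n ≡ m
size-unique s t = Permutation.↔⇒≡ (flipᵢ s ⨾ t)

-- The bijection lists the members in increasing order. Expressing the size as a sum of indicators
-- is what later allows orders of summation to be exchanged.
Fin-subset-size : {P : Pred (Fin n) p} (P? : Decidable P) →
                  HasSize (subsetoid (≡.setoid (Fin n)) P) (∑.sum (λ i → ⟦ P? i ⟧))
Fin-subset-size {n = zero} P? = record
  { to = λ { (() , _) } ; from = λ () ; to-cong = λ { {() , _} }
  ; from-cong = λ { {()} } ; inverse = (λ { {()} }) , (λ { {() , _} }) }
Fin-subset-size {n = suc n} P? with P? zero | Fin-subset-size (P? ∘ suc)
... | yes p₀ | s = record
  { to        = λ { (zero , _) → zero ; (suc i , p) → suc (S.to (i , p)) }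
  ; from      = λ { zero → zero , p₀
                  ; (suc j) → suc (proj₁ (S.from j)) , proj₂ (S.from j) }
  ; to-cong   = λ { {zero , _} {zero , _} _ → refl
                  ; {suc i , _} {suc .i , _} refl → cong suc (S.to-cong refl) }
  ; from-cong = cong _
  ; inverse   = (λ { {zero} {zero , _} _ → refl
                   ; {suc j} {suc i , _} e → cong suc (S.inverseˡ (Fin.suc-injective e)) })
              , (λ { {zero , _} refl → refl
                   ; {suc i , _} refl → cong suc (S.inverseʳ refl) })
  } where module S = Inverse s
... | no ¬p₀ | s = record
  { to        = λ { (zero , p) → contradiction p ¬p₀ ; (suc i , p) → S.to (i , p) }
  ; from      = λ j → suc (proj₁ (S.from j)) , proj₂ (S.from j)
  ; to-cong   = λ { {zero , p} _ → contradiction p ¬p₀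
                  ; {suc i , _} {suc .i , _} refl → S.to-cong refl }
  ; from-cong = cong _
  ; inverse   = (λ { {j} {zero , p} e → contradiction p ¬p₀
                   ; {j} {suc i , _} e → S.inverseˡ (Fin.suc-injective e) })
              , (λ { {zero , p} _ → contradiction p ¬p₀
                   ; {suc i , _} refl → cong suc (S.inverseʳ refl) })
  } where module S = Inverse s

-- Sums and counts over a finite setoid

module Finite {A : Setoid a ℓ} (s : HasSize A n) where
  open Setoid A using (_≈_) renaming (Carrier to C; sym to ≈-sym; trans to ≈-trans; refl to ≈-refl)
  open Inverse s
  open import Data.Nat using (_+_; _*_)

  infix 4 _≟_

  _≟_ : ∀ x y → Dec (x ≈ y)
  x ≟ y = map′ (λ e → ≈-trans (≈-sym (inverseʳ refl)) (inverseʳ e)) to-cong (to x Fin.≟ to y)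

  any? : {P : Pred C p} → Decidable P → P Respects _≈_ → Dec (∃ P)
  any? P? resp = map′ (λ (i , p) → from i , p)
                      (λ (x , p) → to x , resp (≈-sym (inverseʳ refl)) p)
                      (Fin.any? (P? ∘ from))

  ∑ : (C → ℕ) → ℕ
  ∑ f = ∑.sum (f ∘ from)

  # : {P : Pred C p} → Decidable P → ℕ
  # P? = ∑ (λ x → ⟦ P? x ⟧)

  ∑-cong : ∀ {f g : C → ℕ} → (∀ x → f x ≡ g x) → ∑ f ≡ ∑ g
  ∑-cong e = ∑.sum-cong-≗ (e ∘ from)

  ∑-+ : ∀ (f g : C → ℕ) → ∑ (λ x → f x + g x) ≡ ∑ f + ∑ g
  ∑-+ f g = ∑.∑-distrib-+ (f ∘ from) (g ∘ from)

  ∑-*ʳ : ∀ (f : C → ℕ) k → ∑ (λ x → f x * k) ≡ ∑ f * k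
  ∑-*ʳ f k = sym (∑.*-distribʳ-sum k (f ∘ from))

  ∑-const : ∀ k → ∑ (λ _ → k) ≡ n * k
  ∑-const k = go n
    where
    go : ∀ m → ∑.sum {m} (λ _ → k) ≡ m * k
    go zero    = refl
    go (suc m) = cong (k +_) (go m)

  #-cong : {P : Pred C p} {R : Pred C r} (P? : Decidable P) (R? : Decidable R) →
           (∀ x → P x → R x) → (∀ x → R x → P x) → # P? ≡ # R?
  #-cong P? R? f g = ∑-cong λ x → ⟦⟧-cong (P? x) (R? x) (f x) (g x)

  subset-size : {P : Pred C p} (P? : Decidable P) → P Respects _≈_ →
                HasSize (subsetoid A P) (# P?)
  subset-size {P = P} P? resp = iso ⨾ Fin-subset-size (P? ∘ from)
    where
    iso : Inverse (subsetoid A P) (subsetoid (≡.setoid (Fin n)) (P ∘ from))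
    iso = record
      { to        = λ (x , p) → to x , resp (≈-sym (inverseʳ refl)) p
      ; from      = λ (i , p) → from i , p
      ; to-cong   = to-cong
      ; from-cong = from-cong
      ; inverse   = inverseˡ , inverseʳ
      }

  #-size : {P : Pred C p} (P? : Decidable P) → P Respects _≈_ →
           HasSize (subsetoid A P) k → # P? ≡ k
  #-size P? resp = size-unique (subset-size P? resp)

  #-none : {P : Pred C p} (P? : Decidable P) → (∀ x → ¬ P x) → # P? ≡ 0
  #-none P? none = trans (∑-cong λ x → zero-ind (P? x) (none x)) (trans (∑-const 0) (ℕ.*-zeroʳ n))
    where
    zero-ind : ∀ {X : Set p} (X? : Dec X) → ¬ X → ⟦ X? ⟧ ≡ 0
    zero-ind (yes x) ¬x = contradiction x ¬x
    zero-ind (no _)  _  = refl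

  #-unique : {P : Pred C p} (P? : Decidable P) → P Respects _≈_ →
             ∀ x → P x → (∀ y → P y → y ≈ x) → # P? ≡ 1
  #-unique P? resp x px unique = #-size P? resp record
    { to        = λ _ → zero
    ; from      = λ _ → x , px
    ; to-cong   = λ _ → refl
    ; from-cong = λ _ → ≈-refl
    ; inverse   = (λ { {zero} _ → refl }) , λ {z} _ → ≈-sym (unique (proj₁ z) (proj₂ z))
    }

  #-all : # {P = λ _ → C} (λ x → yes x) ≡ n
  #-all = trans (∑-const 1) (ℕ.*-identityʳ n)

  #-split : {P : Pred C p} {R : Pred C r} (P? : Decidable P) (R? : Decidable R) →
            # P? ≡ # (λ x → R? x ×-dec P? x) + # (λ x → ¬? (R? x) ×-dec P? x)
  #-split P? R? = trans (∑-cong λ x → pointwise (P? x) (R? x))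
                        (∑-+ (λ x → ⟦ R? x ×-dec P? x ⟧) (λ x → ⟦ ¬? (R? x) ×-dec P? x ⟧))
    where
    pointwise : ∀ {X : Set p} {Y : Set r} (X? : Dec X) (Y? : Dec Y) →
                ⟦ X? ⟧ ≡ ⟦ Y? ×-dec X? ⟧ + ⟦ ¬? Y? ×-dec X? ⟧
    pointwise (yes _) (yes _) = refl
    pointwise (yes _) (no _)  = refl
    pointwise (no _)  (yes _) = refl
    pointwise (no _)  (no _)  = refl

  #-mono : {P : Pred C p} {R : Pred C r} (P? : Decidable P) (R? : Decidable R) →
           (∀ x → P x → R x) → # P? ℕ.≤ # R?
  #-mono P? R? P⇒R = begin
    # P?                              ≡⟨ #-cong P? (λ x → P? x ×-dec R? x) (λ x p → p , P⇒R x p) (λ _ → proj₁) ⟩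
    # (λ x → P? x ×-dec R? x)         ≤⟨ ℕ.m≤m+n _ _ ⟩
    # (λ x → P? x ×-dec R? x) + # (λ x → ¬? (P? x) ×-dec R? x) ≡⟨ #-split R? P? ⟨
    # R?                              ∎
    where open ℕ.≤-Reasoning

  #-guard : ∀ {Q : Set r} {P : Pred C p} (Q? : Dec Q) (P? : Decidable P) →
            (Q → # P? ≡ k) → # (λ x → Q? ×-dec P? x) ≡ ⟦ Q? ⟧ * k
  #-guard {k = k} Q?@(yes q) P? eq = trans (eq q) (sym (ℕ.*-identityˡ k))
  #-guard Q?@(no ¬q) P? _ = #-none (λ x → Q? ×-dec P? x) (λ x (q , _) → ¬q q)

double-count : {A : Setoid a ℓ} {B : Setoid b ℓ′} (s : HasSize A n) (t : HasSize B m)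
               {R : Setoid.Carrier A → Setoid.Carrier B → Set r} (R? : ∀ x y → Dec (R x y)) →
               Finite.∑ s (λ x → Finite.# t (R? x)) ≡ Finite.∑ t (λ y → Finite.# s (λ x → R? x y))
double-count {n = n} {m = m} s t R? =
  ∑.∑-comm {n} {m} λ i j → ⟦ R? (Inverse.from s i) (Inverse.from t j) ⟧

-- Canonical representatives, quotients and spaces of vectors

least : {P : Pred (Fin n) p} → Decidable P → ∃ P → Fin n
least {n = suc n} P? (i , p) with P? zero
... | yes _  = zero
least {n = suc n} P? (zero  , p) | no ¬p = contradiction p ¬p
least {n = suc n} P? (suc i , p) | no _  = suc (least (P? ∘ suc) (i , p))

least-satisfies : {P : Pred (Fin n) p} (P? : Decidable P) (e : ∃ P) → P (least P? e)
least-satisfies {n = suc n} P? (i , p) with P? zero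
... | yes p₀ = p₀
least-satisfies {n = suc n} P? (zero  , p) | no ¬p = contradiction p ¬p
least-satisfies {n = suc n} P? (suc i , p) | no _  = least-satisfies (P? ∘ suc) (i , p)

-- The least index depends only on the predicate, not on the witness or the decision procedure. This
-- makes the choice of representatives in a quotient respect equality.
least-cong : {P : Pred (Fin n) p} {R : Pred (Fin n) r} (P? : Decidable P) (R? : Decidable R)
             (e : ∃ P) (f : ∃ R) → (∀ i → P i → R i) → (∀ i → R i → P i) → least P? e ≡ least R? f
least-cong {n = suc n} P? R? e f P⇒R R⇒P with P? zero | R? zero
... | yes _ | yes _ = refl
... | yes x | no ¬y = contradiction (P⇒R zero x) ¬y
... | no ¬x | yes y = contradiction (R⇒P zero y) ¬x
least-cong {n = suc n} P? R? (zero , x) f P⇒R R⇒P | no ¬x | no _ = contradiction x ¬x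
least-cong {n = suc n} P? R? (suc i , x) (zero , y) P⇒R R⇒P | no _ | no ¬y = contradiction y ¬y
least-cong {n = suc n} P? R? (suc i , x) (suc j , y) P⇒R R⇒P | no _ | no _ =
  cong suc (least-cong (P? ∘ suc) (R? ∘ suc) (i , x) (j , y) (P⇒R ∘ suc) (R⇒P ∘ suc))

-- The form `2 + r` serves the later arithmetic: it exposes both `q` and `pred q` as successors, so
-- that either can be cancelled.
size≥2 : {A : Setoid a ℓ} → HasSize A n → ∀ {x y} → ¬ (Setoid._≈_ A x y) → ∃ λ r → n ≡ 2 ℕ.+ r
size≥2 {n = zero} s {x} _ with () ← Inverse.to s x
size≥2 {n = suc zero} {A = A} s x≉y =
  contradiction (A.trans (A.sym (inverseʳ refl)) (inverseʳ (all-equal _ _))) x≉y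
  where
  module A = Setoid A
  open Inverse s using (inverseʳ)
  all-equal : ∀ (i j : Fin 1) → i ≡ j
  all-equal zero zero = refl
size≥2 {n = suc (suc r)} _ _ = r , refl

-- Every element is represented by the least index in its fibre under e.
quotient-size : (A : Setoid a ℓ) → let open Setoid A in
                (∀ x y → Dec (x ≈ y)) → (e : Fin n → Carrier) → (∀ x → ∃ λ i → e i ≈ x) →
                ∃ λ m → HasSize A m
quotient-size {n = n} A _≟_ e surj = _ , iso ⨾ Fin-subset-size (λ i → rep (e i) Fin.≟ i)
  where
  open Setoid A renaming (sym to ≈-sym; trans to ≈-trans; refl to ≈-refl)

  rep : Carrier → Fin n
  rep x = least (λ i → e i ≟ x) (surj x)

  e-rep : ∀ x → e (rep x) ≈ x
  e-rep x = least-satisfies (λ i → e i ≟ x) (surj x)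

  rep-cong : ∀ {x y} → x ≈ y → rep x ≡ rep y
  rep-cong x≈y = least-cong _ _ (surj _) (surj _)
    (λ _ p → ≈-trans p x≈y) (λ _ p → ≈-trans p (≈-sym x≈y))

  iso : Inverse A (subsetoid (≡.setoid (Fin n)) (λ i → rep (e i) ≡ i))
  iso = record
    { to        = λ x → rep x , rep-cong (e-rep x)
    ; from      = λ (i , _) → e i
    ; to-cong   = rep-cong
    ; from-cong = λ { refl → ≈-refl }
    ; inverse   = (λ { {_ , fix} x≈ → trans (rep-cong x≈) fix })
                , (λ { refl → e-rep _ })
    }

-- A vector is read as a numeral with `d` digits in base `q`. Vectors are functions compared
-- pointwise, so the encoding needs its own congruence lemma.
Vector-size : ∀ {a ℓ} {A : Setoid a ℓ} {q} → HasSize A q → ∀ d → HasSize (VecEq.≋-setoid A d) (q ^ d)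
Vector-size {A = A} {q} s d = record
  { to        = λ v → Fin.funToFin (to ∘ v)
  ; from      = λ k → from ∘ Fin.finToFun k
  ; to-cong   = λ e → funToFin-cong (to-cong ∘ e)
  ; from-cong = λ { refl → VecEq.≋-refl A }
  ; inverse   = (λ {k} e → trans (funToFin-cong (inverseˡ ∘ e)) (Fin.funToFin-finToFin {d} k))
              , (λ { {v} refl i → inverseʳ (Fin.finToFun-funToFin (to ∘ v) i) })
  }
  where
  open Inverse s
  funToFin-cong : ∀ {m n} {f g : Fin m → Fin n} → (∀ i → f i ≡ g i) → Fin.funToFin f ≡ Fin.funToFin g
  funToFin-cong {zero}  e = refl
  funToFin-cong {suc m} e = cong₂ Fin.combine (e zero) (funToFin-cong (e ∘ suc))

-- Subspaces of F⁴

module Geometry {c ℓ₁ ℓ₂} (F : HeytingField c ℓ₁ ℓ₂) {q : ℕ} (sizeF : HasSize (PG3.scalars F) q) where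
  open PG3 F
  open HeytingField F using (tight; #⇒invertible)
  open HeytingCommutativeRingProperties (HeytingField.heytingCommutativeRing F) using (1#0)
  private
    R : CommutativeRing c ℓ₁
    R = HeytingCommutativeRing.commutativeRing (HeytingField.heytingCommutativeRing F)
  open CommutativeRing R
    using ( 1#; -_; _-_; ring; semiring; +-commutativeSemigroup
          ; +-cong; +-congˡ; +-congʳ; +-assoc; +-comm; +-identityˡ; +-identityʳ
          ; *-congˡ; *-congʳ; *-assoc; *-comm; *-identityˡ; zeroˡ; zeroʳ
          ; distribˡ; distribʳ; -‿inverseˡ; -‿inverseʳ)
    renaming (sym to ≈-sym; trans to ≈-trans)
  open RingProperties ring using (-0#≈0#; -‿distribˡ-*; -1*x≈-x; -‿+-comm) renaming (x∙y⁻¹≈ε⇒x≈y to x-y≈0⇒x≈y)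
  open SemiringSum semiring using (sum; sum-cong-≋; ∑-distrib-+; *-distribˡ-sum)
  open VecEq scalars using (_≋_; ≋-setoid; ≋-refl; ≋-sym; ≋-trans)
  open CommutativeSemigroupProperties +-commutativeSemigroup using (interchange)
  open ≡.≡-Reasoning using (step-≡-⟩; step-≡-⟨) renaming (begin_ to begin-≡_; _∎ to _∎-≡)
  open SetoidReasoning scalars using (begin_; _∎; step-≈-⟩; step-≈-⟨)

  -- Decisions and inverses from finiteness of the field

  module FC = Finite sizeF
  open FC using () renaming (_≟_ to _≟ᶜ_)

  -- Finiteness makes the existence of an inverse decidable, so it is enough to refute its absence.
  -- Without an inverse `x` could not be apart from zero, and tightness would make it equal to zero.
  invert : ∀ x → ¬ (x ≈ 0#) → ∃ λ y → y * x ≈ 1#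
  invert x x≉0 = decidable-stable (FC.any? (λ y → (y * x) ≟ᶜ 1#) λ e p → ≈-trans (*-congʳ (≈-sym e)) p)
    λ none → x≉0 (proj₁ (tight x 0#) λ x#0 → none (let (y , yx , _) = #⇒invertible x#0 in
      y , ≈-trans (*-congˡ (≈-sym (≈-trans (+-congˡ -0#≈0#) (+-identityʳ x)))) yx))

  *-cancel : ∀ {x y} → ¬ (x ≈ 0#) → x * y ≈ 0# → y ≈ 0#
  *-cancel {x} {y} x≉0 xy≈0 with invert x x≉0
  ... | z , zx≈1 = begin
    y           ≈⟨ *-identityˡ y ⟨
    1# * y      ≈⟨ *-congʳ zx≈1 ⟨
    z * x * y   ≈⟨ *-assoc z x y ⟩
    z * (x * y) ≈⟨ *-congˡ xy≈0 ⟩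
    z * 0#      ≈⟨ zeroʳ z ⟩
    0#          ∎

  sizeV : HasSize (≋-setoid 4) (q ^ 4)
  sizeV = Vector-size sizeF 4

  module FV = Finite sizeV
  open FV public using () renaming (_≟_ to _≟ᵛ_)

  mem? : ∀ U → Decidable (Mem U)
  mem? = Subspace.mem?

  mem-resp : ∀ U → Mem U Respects _≋_
  mem-resp U = Subspace.mem-resp U

  +-mem : ∀ U {u w} → Mem U u → Mem U w → Mem U (u +ᵛ w)
  +-mem U = Subspace.+-closed U

  *-mem : ∀ U a {u} → Mem U u → Mem U (a *ᵛ u)
  *-mem U = Subspace.*-closed U

  cancel-multiples : ∀ {a b} → a + b ≈ 0# → ∀ (u v : V) → ((u +ᵛ (a *ᵛ v)) +ᵛ (b *ᵛ v)) ≋ u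
  cancel-multiples {a} {b} a+b≈0 u v j = begin
    u j + a * v j + b * v j   ≈⟨ +-assoc _ _ _ ⟩
    u j + (a * v j + b * v j) ≈⟨ +-congˡ (distribʳ _ _ _) ⟨
    u j + (a + b) * v j       ≈⟨ +-congˡ (*-congʳ a+b≈0) ⟩
    u j + 0# * v j            ≈⟨ +-congˡ (zeroˡ _) ⟩
    u j + 0#                  ≈⟨ +-identityʳ _ ⟩
    u j                       ∎

  unscale : ∀ U {v} a → ¬ (a ≈ 0#) → Mem U (a *ᵛ v) → Mem U v
  unscale U {v} a a≉0 m with invert a a≉0
  ... | b , ba≈1 = mem-resp U (λ j → ≈-trans (≈-sym (*-assoc b a (v j))) (≈-trans (*-congʳ ba≈1) (*-identityˡ _)))
      (*-mem U b m)

  combination-mem : ∀ U {d} a (b : Vector V d) → (∀ i → Mem U (b i)) → Mem U (combination a b)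
  combination-mem U {zero}  a b m = Subspace.0-closed U
  combination-mem U {suc d} a b m =
    +-mem U (*-mem U (a zero) (m zero)) (combination-mem U (a ∘ suc) (b ∘ suc) (m ∘ suc))

  basis-⊑ : ∀ {d} (X : Flat d) U → (∀ i → Mem U (proj₁ (proj₂ X) i)) → ⟨ X ⟩ ⊑ U
  basis-⊑ (_ , b , isB) U m u∈ = let (a , e) = IsBasis.spanning isB u∈ in
    mem-resp U (≋-sym e) (combination-mem U a b m)

  infix 4 _⊑?_ _≐?_

  abstract
    -- Inclusion of a flat can be tested on its finitely many basis vectors.
    _⊑?_ : ∀ {d} (X : Flat d) U → Dec (⟨ X ⟩ ⊑ U)
    X ⊑? U = map′ (λ m {x} → basis-⊑ X U m {x}) (λ f i → f (IsBasis.mem (proj₂ (proj₂ X)) i))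
      (Fin.all? (λ i → mem? U (proj₁ (proj₂ X) i)))

  _≐?_ : ∀ {d e} (X : Flat d) (Y : Flat e) → Dec (⟨ X ⟩ ≐ ⟨ Y ⟩)
  X ≐? Y = (X ⊑? ⟨ Y ⟩) ×-dec (Y ⊑? ⟨ X ⟩)

  -- Taking coordinates is a bijection onto the vectors of length `d`. Uniqueness of coordinates is
  -- independence applied to the difference of two coordinate vectors.
  flat-size : ∀ {d} (X : Flat d) → HasSize (subsetoid (≋-setoid 4) (Mem ⟨ X ⟩)) (q ^ d)
  flat-size {d} (U , b , isB) = iso ⨾ Vector-size sizeF d
    where
    open IsBasis isB

    combination-cong : ∀ {a a′} → a ≋ a′ → combination a b ≋ combination a′ b
    combination-cong e j = sum-cong-≋ (λ i → *-congʳ (e i))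

    coordinates-unique : ∀ {a a′} → combination a b ≋ combination a′ b → a ≋ a′
    coordinates-unique {a} {a′} e i = begin
      a i                   ≈⟨ +-identityʳ _ ⟨
      a i + 0#              ≈⟨ +-congˡ (-‿inverseˡ (a′ i)) ⟨
      a i + (- a′ i + a′ i) ≈⟨ +-assoc _ _ _ ⟨
      a i - a′ i + a′ i     ≈⟨ +-congʳ (independent (λ i → a i - a′ i) difference i) ⟩
      0# + a′ i             ≈⟨ +-identityˡ _ ⟩
      a′ i                  ∎
      where
      difference : combination (λ i → a i - a′ i) b ≋ 0ᵛ
      difference j = begin
        sum (λ i → (a i - a′ i) * b i j)
          -- The minus sign becomes the factor `- 1#`, which can be pulled out of the sum.
          ≈⟨ sum-cong-≋ {x = λ i → (a i - a′ i) * b i j} {y = λ i → a i * b i j + - 1# * (a′ i * b i j)}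
               (λ i → ≈-trans (distribʳ (b i j) (a i) (- a′ i))
                 (+-congˡ (≈-trans (*-congʳ (≈-sym (-1*x≈-x (a′ i)))) (*-assoc (- 1#) (a′ i) (b i j))))) ⟩
        sum (λ i → a i * b i j + - 1# * (a′ i * b i j))
          ≈⟨ ∑-distrib-+ (λ i → a i * b i j) (λ i → - 1# * (a′ i * b i j)) ⟩
        combination a b j + sum (λ i → - 1# * (a′ i * b i j))
          ≈⟨ +-cong (e j) (≈-sym (*-distribˡ-sum (- 1#) (λ i → a′ i * b i j))) ⟩
        combination a′ b j + - 1# * combination a′ b j
          ≈⟨ +-congˡ (-1*x≈-x _) ⟩
        combination a′ b j - combination a′ b j
          ≈⟨ -‿inverseʳ _ ⟩
        0# ∎

    iso : Inverse (subsetoid (≋-setoid 4) (Mem U)) (≋-setoid d)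
    iso = record
      { to        = λ (u , u∈) → proj₁ (spanning u∈)
      ; from      = λ a → combination a b , combination-mem U a b mem
      ; to-cong   = λ {(u , u∈)} {(w , w∈)} e → coordinates-unique
          (≋-trans (≋-sym (proj₂ (spanning u∈))) (≋-trans e (proj₂ (spanning w∈))))
      ; from-cong = combination-cong
      ; inverse   = (λ {a} {(u , u∈)} e → coordinates-unique (≋-trans (≋-sym (proj₂ (spanning u∈))) e))
                  , (λ {(u , u∈)} e → ≋-trans (combination-cong e) (≋-sym (proj₂ (spanning u∈))))
      }

  -- Points, and the relation between vector and point counts

  #vectors : Subspace → ℕ
  #vectors U = FV.# (mem? U)

  #vectors-flat : ∀ {d} (X : Flat d) → #vectors ⟨ X ⟩ ≡ q ^ d
  #vectors-flat X = FV.#-size (mem? ⟨ X ⟩) (mem-resp ⟨ X ⟩) (flat-size X)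

  generator : Point → V
  generator x = proj₁ (proj₂ x) zero

  generator∈ : ∀ x → Mem ⟨ x ⟩ (generator x)
  generator∈ x = IsBasis.mem (proj₂ (proj₂ x)) zero

  1≉0 : ¬ (1# ≈ 0#)
  1≉0 e = proj₂ (tight 1# 0#) e 1#0

  two≤q : ∃ λ r → q ≡ 2 ℕ.+ r
  two≤q = size≥2 sizeF 1≉0

  multiple-of-generator : ∀ x {u} → Mem ⟨ x ⟩ u → ∃ λ a → u ≋ a *ᵛ generator x
  multiple-of-generator (_ , b , isB) u∈ = let (a , e) = IsBasis.spanning isB u∈ in
    a zero , λ j → ≈-trans (e j) (+-identityʳ _)

  generator≉0 : ∀ x → ¬ (generator x ≋ 0ᵛ)
  generator≉0 (_ , b , isB) g≈0 = 1≉0 (IsBasis.independent isB (λ _ → 1#)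
    (λ j → ≈-trans (+-identityʳ _) (≈-trans (*-identityˡ _) (g≈0 j))) zero)

  -- A nonzero vector of a point is an invertible multiple of its generator, so one nonzero common
  -- vector puts the whole point inside `U`. Points are thus atoms among the subspaces.
  point-⊑ : ∀ x U {u} → ¬ (u ≋ 0ᵛ) → Mem ⟨ x ⟩ u → Mem U u → ⟨ x ⟩ ⊑ U
  point-⊑ x U {u} u≉0 u∈x u∈U = let (a , u≋ag) = multiple-of-generator x u∈x in
    basis-⊑ x U λ { zero → unscale U a
      (λ a≈0 → u≉0 λ j → ≈-trans (u≋ag j) (≈-trans (*-congʳ a≈0) (zeroˡ _)))
      (mem-resp U u≋ag u∈U) }

  point-⊑-sym : ∀ x y → ⟨ x ⟩ ⊑ ⟨ y ⟩ → ⟨ y ⟩ ⊑ ⟨ x ⟩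
  point-⊑-sym x y x⊑y = point-⊑ y ⟨ x ⟩ (generator≉0 x) (x⊑y (generator∈ x)) (generator∈ x)

  span : V → Subspace
  span v = record
    { Mem      = λ u → ∃ λ a → u ≋ a *ᵛ v
    ; mem?     = λ u → FC.any? (λ a → u ≟ᵛ (a *ᵛ v)) λ e f j → ≈-trans (f j) (*-congʳ e)
    ; mem-resp = λ e (a , f) → a , ≋-trans (≋-sym e) f
    ; 0-closed = 0# , λ _ → ≈-sym (zeroˡ _)
    ; +-closed = λ (a , e) (b , f) → a + b , λ j → ≈-trans (+-cong (e j) (f j)) (≈-sym (distribʳ _ _ _))
    ; *-closed = λ b (a , e) → b * a , λ j → ≈-trans (*-congˡ (e j)) (≈-sym (*-assoc _ _ _))
    }

  ∈-span : ∀ v → Mem (span v) v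
  ∈-span v = 1# , λ _ → ≈-sym (*-identityˡ _)

  zero-span : ∀ {u} → Mem (span 0ᵛ) u → u ≋ 0ᵛ
  zero-span (a , e) j = ≈-trans (e j) (zeroʳ a)

  nonzero-coordinate : ∀ v → ¬ (v ≋ 0ᵛ) → ∃ λ j → ¬ (v j ≈ 0#)
  nonzero-coordinate v v≉0 = Fin.¬∀⟶∃¬ 4 _ (λ j → v j ≟ᶜ 0#) v≉0

  point : ∀ v → ¬ (v ≋ 0ᵛ) → Point
  point v v≉0 = span v , (λ _ → v) , record
    { mem         = λ _ → ∈-span v
    ; independent = λ { a e zero → let (j , vj≉0) = nonzero-coordinate v v≉0 in
        *-cancel vj≉0 (≈-trans (*-comm _ _) (≈-trans (≈-sym (+-identityʳ _)) (e j))) }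
    ; spanning    = λ (a , e) → (λ _ → a) , λ j → ≈-trans (e j) (≈-sym (+-identityʳ _))
    }

  ≈-point : ∀ x {v} (v≉0 : ¬ (v ≋ 0ᵛ)) → Mem ⟨ x ⟩ v → x ≈ₚ point v v≉0
  ≈-point x {v} v≉0 v∈x = point-⊑ x (span v) v≉0 v∈x (∈-span v)
                        , point-⊑ (point v v≉0) ⟨ x ⟩ v≉0 (∈-span v) v∈x

  nonzero? : ∀ v → Dec (¬ (v ≋ 0ᵛ))
  nonzero? v = ¬? (v ≟ᵛ 0ᵛ)

  abstract
    -- Each point is spanned by its generator, so the points are a quotient of the finite set of
    -- nonzero vectors.
    points-finite : ∃ λ n → HasSize (flats 1) n
    points-finite = quotient-size (flats 1) _≐?_ (λ i → point (proj₁ (from i)) (proj₂ (from i)))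
      λ x → let g = generator x , generator≉0 x
                g≈ = ≋-sym (FV≉0.inverseʳ {g} {to g} refl)
            in to g , Setoid.sym (flats 1) {x} {point _ (proj₂ (from (to g)))}
                        (≈-point x (proj₂ (from (to g))) (mem-resp ⟨ x ⟩ g≈ (generator∈ x)))
      where
      module FV≉0 = Inverse (FV.subset-size nonzero? λ e v≉0 w≈0 → v≉0 (≋-trans e w≈0))
      open FV≉0 using (to; from)

  module FP = Finite (proj₂ points-finite)

  #points : Subspace → ℕ
  #points U = FP.# (_⊑? U)

  #vectors≡1+#nonzero : ∀ U → #vectors U ≡ 1 ℕ.+ FV.# (λ v → nonzero? v ×-dec mem? U v)
  #vectors≡1+#nonzero U = trans (FV.#-split (mem? U) (_≟ᵛ 0ᵛ))
    (cong (ℕ._+ FV.# (λ v → nonzero? v ×-dec mem? U v)) (FV.#-unique (λ v → (v ≟ᵛ 0ᵛ) ×-dec mem? U v)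
      (λ e (v≈0 , v∈) → ≋-trans (≋-sym e) v≈0 , mem-resp U e v∈)
      0ᵛ (≋-refl , Subspace.0-closed U) (λ _ (v≈0 , _) → v≈0)))

  -- Double counting of incident pairs of a nonzero vector of `U` and a point: each such vector lies
  -- on exactly one point, and each point has `pred q` nonzero vectors. The summand 1 is the zero
  -- vector.
  #vectors≡1+#points*[q-1] : ∀ U → #vectors U ≡ 1 ℕ.+ #points U ℕ.* ℕ.pred q
  #vectors≡1+#points*[q-1] U = trans (#vectors≡1+#nonzero U) (cong suc (begin-≡
    FV.# N?
      ≡⟨ FV.∑-cong (λ v → ℕ.*-identityʳ ⟦ N? v ⟧) ⟨
    FV.∑ (λ v → ⟦ N? v ⟧ ℕ.* 1)
      ≡⟨ FV.∑-cong (λ v → FP.#-guard (N? v) (λ x → mem? ⟨ x ⟩ v) (unique-point v)) ⟨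
    FV.∑ (λ v → FP.# (λ x → N? v ×-dec mem? ⟨ x ⟩ v))
      ≡⟨ double-count sizeV (proj₂ points-finite) (λ v x → N? v ×-dec mem? ⟨ x ⟩ v) ⟩
    FP.∑ (λ x → FV.# (λ v → N? v ×-dec mem? ⟨ x ⟩ v))
      -- A nonzero vector of `⟨ x ⟩` lies in `U` exactly when all of `⟨ x ⟩` does, so the test moves
      -- from the vector to the point.
      ≡⟨ FP.∑-cong (λ x → FV.#-cong (λ v → N? v ×-dec mem? ⟨ x ⟩ v)
           (λ v → (x ⊑? U) ×-dec (nonzero? v ×-dec mem? ⟨ x ⟩ v))
           (λ v ((v≉0 , v∈U) , v∈x) → (λ {y} → point-⊑ x U v≉0 v∈x v∈U {y}) , v≉0 , v∈x)
           (λ v (x⊑U , v≉0 , v∈x) → (v≉0 , x⊑U v∈x) , v∈x)) ⟩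
    FP.∑ (λ x → FV.# (λ v → (x ⊑? U) ×-dec (nonzero? v ×-dec mem? ⟨ x ⟩ v)))
      ≡⟨ FP.∑-cong (λ x → FV.#-guard (x ⊑? U) (λ v → nonzero? v ×-dec mem? ⟨ x ⟩ v)
           λ _ → #nonzero-of-point x) ⟩
    FP.∑ (λ x → ⟦ x ⊑? U ⟧ ℕ.* ℕ.pred q)
      ≡⟨ FP.∑-*ʳ (λ x → ⟦ x ⊑? U ⟧) (ℕ.pred q) ⟩
    #points U ℕ.* ℕ.pred q ∎-≡))
    where
    N? : Decidable (λ v → ¬ (v ≋ 0ᵛ) × Mem U v)
    N? v = nonzero? v ×-dec mem? U v

    unique-point : ∀ v → ¬ (v ≋ 0ᵛ) × Mem U v → FP.# (λ x → mem? ⟨ x ⟩ v) ≡ 1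
    unique-point v (v≉0 , _) = FP.#-unique (λ x → mem? ⟨ x ⟩ v) (λ x≈y v∈x → proj₁ x≈y v∈x)
      (point v v≉0) (∈-span v) (λ x v∈x → ≈-point x v≉0 v∈x)

    #nonzero-of-point : ∀ x → FV.# (λ v → nonzero? v ×-dec mem? ⟨ x ⟩ v) ≡ ℕ.pred q
    #nonzero-of-point x = cong ℕ.pred (trans (sym (#vectors≡1+#nonzero ⟨ x ⟩))
      (trans (#vectors-flat x) (ℕ.*-identityʳ q)))

  -- Intersections and hyperplane sections

  infixl 7 _⊓_

  _⊓_ : Subspace → Subspace → Subspace
  U ⊓ W = record
    { Mem      = λ u → Mem U u × Mem W u
    ; mem?     = λ u → mem? U u ×-dec mem? W u
    ; mem-resp = λ e (m , n) → mem-resp U e m , mem-resp W e n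
    ; 0-closed = Subspace.0-closed U , Subspace.0-closed W
    ; +-closed = λ (m , n) (m′ , n′) → +-mem U m m′ , +-mem W n n′
    ; *-closed = λ a (m , n) → *-mem U a m , *-mem W a n
    }

  ⊤ˢ : Subspace
  ⊤ˢ = record
    { Mem      = λ _ → Level.Lift (c ⊔ ℓ₁) ⊤
    ; mem?     = λ _ → yes _
    ; mem-resp = λ _ _ → _
    ; 0-closed = _
    ; +-closed = λ _ _ → _
    ; *-closed = λ _ _ → _
    }

  infixl 6 _∔_

  -- The sum of `H` and the span of `v`, encoded by shifting `w` into `H` along `v`. The only
  -- existential ranges over the finite field, so membership is decidable.
  _∔_ : Subspace → V → Subspace
  H ∔ v = record
    { Mem      = λ w → ∃ λ a → Mem H (w +ᵛ (a *ᵛ v))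
    ; mem?     = λ w → FC.any? (λ a → mem? H (w +ᵛ (a *ᵛ v)))
        λ e → mem-resp H λ j → +-congˡ (*-congʳ e)
    ; mem-resp = λ e (a , m) → a , mem-resp H (λ j → +-congʳ (e j)) m
    ; 0-closed = 0# , mem-resp H (λ j → ≈-trans (≈-sym (zeroˡ _)) (≈-sym (+-identityˡ _))) (Subspace.0-closed H)
    ; +-closed = λ {u} {w} (a , m) (b , n) → a + b , mem-resp H
        (λ j → ≈-trans (interchange (u j) (a * v j) (w j) (b * v j)) (+-congˡ (≈-sym (distribʳ (v j) a b))))
        (+-mem H m n)
    ; *-closed = λ b {u} (a , m) → b * a , mem-resp H
        (λ j → ≈-trans (distribˡ b (u j) (a * v j)) (+-congˡ (≈-sym (*-assoc b a (v j))))) (*-mem H b m)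
    }

  ⊑-∔ : ∀ H v → H ⊑ H ∔ v
  ⊑-∔ H v m = 0# , mem-resp H (λ j → ≈-sym (≈-trans (+-congˡ (zeroˡ _)) (+-identityʳ _))) m

  ∈-∔ : ∀ H v → Mem (H ∔ v) v
  ∈-∔ H v = - 1# , mem-resp H (λ j → ≈-sym (≈-trans (+-congˡ (-1*x≈-x _)) (-‿inverseʳ _))) (Subspace.0-closed H)

  -- H = F⁴ is allowed.
  IsHyperplane : Subspace → Set (c ⊔ ℓ₁)
  IsHyperplane H = ∀ v → ¬ Mem H v → ∀ w → Mem (H ∔ v) w

  -- Double counting of the pairs `w` in `K` and scalar `a` with `w +ᵛ (a *ᵛ v)` in `H`. For given
  -- `w` such an `a` exists because `H ∔ v` is the whole space, and it is unique because two of them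
  -- would put a nonzero multiple of `v` into `H`. For given `a` the vectors `w` form a translate of
  -- `K ⊓ H`, as `v` lies in `K`.
  #vectors-section : ∀ H K v → IsHyperplane H → Mem K v → ¬ Mem H v → #vectors K ≡ q ℕ.* #vectors (K ⊓ H)
  #vectors-section H K v hyp v∈K v∉H = begin-≡
    FV.# (mem? K)
      ≡⟨ FV.∑-cong (λ w → ℕ.*-identityʳ ⟦ mem? K w ⟧) ⟨
    FV.∑ (λ w → ⟦ mem? K w ⟧ ℕ.* 1)
      ≡⟨ FV.∑-cong (λ w → FC.#-guard (mem? K w) (λ a → mem? H (w +ᵛ (a *ᵛ v))) λ _ → unique-shift w) ⟨
    FV.∑ (λ w → FC.# (λ a → mem? K w ×-dec mem? H (w +ᵛ (a *ᵛ v))))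
      ≡⟨ double-count sizeV sizeF (λ w a → mem? K w ×-dec mem? H (w +ᵛ (a *ᵛ v))) ⟩
    FC.∑ (λ a → FV.# (λ w → mem? K w ×-dec mem? H (w +ᵛ (a *ᵛ v))))
      ≡⟨ FC.∑-cong translate ⟩
    FC.∑ (λ _ → #vectors (K ⊓ H))
      ≡⟨ FC.∑-const (#vectors (K ⊓ H)) ⟩
    q ℕ.* #vectors (K ⊓ H) ∎-≡
    where
    shifted-resp : ∀ w {a b} → a ≈ b → Mem H (w +ᵛ (a *ᵛ v)) → Mem H (w +ᵛ (b *ᵛ v))
    shifted-resp w e = mem-resp H (λ j → +-congˡ (*-congʳ e))

    shift-unique : ∀ w {a b} → Mem H (w +ᵛ (a *ᵛ v)) → Mem H (w +ᵛ (b *ᵛ v)) → b ≈ a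
    shift-unique w {a} {b} m n = decidable-stable (b ≟ᶜ a) λ b≉a → v∉H
      (unscale H (b - a) (λ e → b≉a (x-y≈0⇒x≈y b a e))
        (mem-resp H (λ j → difference (w j) a b (v j)) (+-mem H n (*-mem H (- 1#) m))))
      where
      difference : ∀ w a b v → (w + b * v) + - 1# * (w + a * v) ≈ (b - a) * v
      difference w a b v = begin
        (w + b * v) + - 1# * (w + a * v)   ≈⟨ +-congˡ (-1*x≈-x _) ⟩
        (w + b * v) - (w + a * v)          ≈⟨ +-congʳ (+-comm _ _) ⟩
        (b * v + w) - (w + a * v)          ≈⟨ +-congˡ (-‿+-comm w (a * v)) ⟨
        (b * v + w) + (- w - a * v)        ≈⟨ +-assoc _ _ _ ⟩
        b * v + (w + (- w - a * v))        ≈⟨ +-congˡ (+-assoc _ _ _) ⟨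
        b * v + ((w - w) - a * v)          ≈⟨ +-congˡ (+-congʳ (-‿inverseʳ w)) ⟩
        b * v + (0# - a * v)               ≈⟨ +-congˡ (+-identityˡ _) ⟩
        b * v - a * v                      ≈⟨ +-congˡ (-‿distribˡ-* a v) ⟩
        b * v + - a * v                    ≈⟨ distribʳ v b (- a) ⟨
        (b - a) * v                        ∎

    unique-shift : ∀ w → FC.# (λ a → mem? H (w +ᵛ (a *ᵛ v))) ≡ 1
    unique-shift w = let (a , m) = hyp v v∉H w in
      FC.#-unique (λ a → mem? H (w +ᵛ (a *ᵛ v))) (shifted-resp w) a m λ b n → shift-unique w m n

    translate : ∀ a → FV.# (λ w → mem? K w ×-dec mem? H (w +ᵛ (a *ᵛ v))) ≡ #vectors (K ⊓ H)
    translate a = FV.#-size (λ w → mem? K w ×-dec mem? H (w +ᵛ (a *ᵛ v)))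
      (λ e (m , n) → mem-resp K e m , mem-resp H (λ j → +-congʳ (e j)) n)
      (iso ⨾ FV.subset-size (mem? (K ⊓ H)) (mem-resp (K ⊓ H)))
      where
      add-cancel = λ u → cancel-multiples (-‿inverseˡ a) u v
      sub-cancel = λ u → cancel-multiples (-‿inverseʳ a) u v

      iso : Inverse (subsetoid (≋-setoid 4) (λ w → Mem K w × Mem H (w +ᵛ (a *ᵛ v))))
                    (subsetoid (≋-setoid 4) (Mem (K ⊓ H)))
      iso = record
        { to        = λ (w , w∈K , m) → w +ᵛ (a *ᵛ v) , +-mem K w∈K (*-mem K a v∈K) , m
        ; from      = λ (u , u∈K , u∈H) → u +ᵛ ((- a) *ᵛ v) , +-mem K u∈K (*-mem K (- a) v∈K)
                                        , mem-resp H (≋-sym (add-cancel u)) u∈H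
        ; to-cong   = λ e j → +-congʳ (e j)
        ; from-cong = λ e j → +-congʳ (e j)
        ; inverse   = (λ {(u , _)} {(w , _)} e j → ≈-trans (+-congʳ (e j)) (add-cancel u j))
                    , (λ {(w , _)} {(u , _)} e j → ≈-trans (+-congʳ (e j)) (sub-cancel w j))
        }

-- Arithmetic: the factor `q - 1` of powers of `q` minus one

open import Data.Nat using (_+_; _*_; _∸_; pred)

cancel-pred : ∀ {q} → (∃ λ r → q ≡ 2 + r) → ∀ {m n} → 1 + m * pred q ≡ 1 + n * pred q → m ≡ n
cancel-pred (r , refl) {m} {n} e = ℕ.*-cancelʳ-≡ m n (suc r) (ℕ.suc-injective e)

cancel-q : ∀ {q} → (∃ λ r → q ≡ 2 + r) → ∀ {m n} → q * m ≡ q * n → m ≡ n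
cancel-q (r , refl) {m} {n} e = ℕ.*-cancelˡ-≡ m n (2 + r) e

-- The ring solver does not treat _^_, so the powers are unfolded in the identities.
q^1-1-factor : ∀ {q} → (∃ λ r → q ≡ 2 + r) → q ≡ 1 + 1 * pred q
q^1-1-factor (r , refl) = identity r
  where
  identity : ∀ r → 2 + r ≡ 1 + (1 * (1 + r))
  identity = solve-∀

q^2-1-factor : ∀ {q} → (∃ λ r → q ≡ 2 + r) → q ^ 2 ≡ 1 + ((q + 1) * pred q)
q^2-1-factor (r , refl) = identity r
  where
  identity : ∀ r → (2 + r) * ((2 + r) * 1) ≡ 1 + ((2 + r + 1) * (1 + r))
  identity = solve-∀

q^3-1-factor : ∀ {q} → (∃ λ r → q ≡ 2 + r) → q ^ 3 ≡ 1 + ((q ^ 2 + q + 1) * pred q)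
q^3-1-factor (r , refl) = identity r
  where
  identity : ∀ r → (2 + r) * ((2 + r) * ((2 + r) * 1)) ≡ 1 + ((((2 + r) * ((2 + r) * 1)) + (2 + r) + 1) * (1 + r))
  identity = solve-∀

q^4-1-factor : ∀ {q} → (∃ λ r → q ≡ 2 + r) → q ^ 4 ≡ 1 + ((q ^ 2 + 1) * (q + 1) * pred q)
q^4-1-factor (r , refl) = identity r
  where
  identity : ∀ r → (2 + r) * ((2 + r) * ((2 + r) * ((2 + r) * 1))) ≡
             1 + ((((2 + r) * ((2 + r) * 1)) + 1) * (2 + r + 1) * (1 + r))
  identity = solve-∀

-- Polarities

module Symplectic {c ℓ₁ ℓ₂} (F : HeytingField c ℓ₁ ℓ₂) {q : ℕ} (sizeF : HasSize (PG3.scalars F) q)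
                  (ζ : PG3.SymplecticPolarity F) where
  open PG3 F hiding (_+_; _*_; Carrier; _≈_; 0#)
  open Geometry F sizeF
  open SymplecticPolarity ζ
  open VecEq scalars using (≋-setoid; _≋_; ≋-sym)

  _⊥ : Point → Subspace
  x ⊥ = ⟨ x ⟩ ^ζ

  -- The search for a vector of `U` outside `W` is finite, so a refuted inclusion yields an actual
  -- vector.
  ⋢⇒witness : ∀ U W → ¬ (U ⊑ W) → ∃ λ v → Mem U v × ¬ Mem W v
  ⋢⇒witness U W U⋢W = decidable-stable
    (FV.any? (λ v → mem? U v ×-dec ¬? (mem? W v))
      λ e (v∈ , v∉) → mem-resp U e v∈ , λ w∈ → v∉ (mem-resp W (≋-sym e) w∈))
    λ none → U⋢W λ {v} v∈ → decidable-stable (mem? W v) λ v∉ → none (v , v∈ , v∉)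

  -- If H ∔ v is properly larger than x ⊥, its polar is properly contained in
  -- the atom ⟨ x ⟩, hence zero.
  ⊥-isHyperplane : ∀ x → IsHyperplane (x ⊥)
  -- The zero space `W ^ζ` lies in `⊤ˢ ^ζ`; applying the polarity again reverses this to `⊤ˢ ⊑ W`.
  ⊥-isHyperplane x v v∉H w = proj₁ (involutive W)
    (antitone {W ^ζ} {⊤ˢ ^ζ} polar-⊑ (proj₂ (involutive ⊤ˢ) _))
    where
    H W : Subspace
    H = x ⊥
    W = H ∔ v

    W⋢H : ¬ (W ⊑ H)
    W⋢H W⊑H = v∉H (W⊑H (∈-∔ H v))

    polar-zero : ∀ {u} → Mem (W ^ζ) u → u ≋ 0ᵛ
    polar-zero {u} u∈ = decidable-stable (u ≟ᵛ 0ᵛ) λ u≉0 →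
      let u∈x = proj₁ (involutive ⟨ x ⟩) (antitone {H} {W} (⊑-∔ H v) u∈)
          x⊑W^ζ : ⟨ x ⟩ ⊑ W ^ζ
          x⊑W^ζ = point-⊑ x (W ^ζ) u≉0 u∈x u∈
      in W⋢H λ m → antitone {⟨ x ⟩} {W ^ζ} x⊑W^ζ (proj₂ (involutive W) m)

    polar-⊑ : W ^ζ ⊑ ⊤ˢ ^ζ
    polar-⊑ u∈ = mem-resp (⊤ˢ ^ζ) (≋-sym (polar-zero u∈)) (Subspace.0-closed (⊤ˢ ^ζ))

  -- If `x ⊥` were everything, its polar `⟨ x ⟩` would lie in `⊤ˢ ^ζ`. That is contained in every
  -- polar, in particular in `(O ^ζ) ^ζ`, which is zero, whereas the generator of a point is not.
  ⊥-proper : ∀ x → ¬ (⊤ˢ ⊑ x ⊥)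
  ⊥-proper x ⊤⊑x⊥ = generator≉0 x (zero-span (proj₁ (involutive O)
    (antitone {O ^ζ} {⊤ˢ} _ (antitone {⊤ˢ} {x ⊥} ⊤⊑x⊥ (proj₂ (involutive ⟨ x ⟩) (generator∈ x))))))
    where
    O = span 0ᵛ

  -- One inclusion suffices: the polarity turns it into an inclusion between points, and these are
  -- atoms.
  ⊥-injective : ∀ x y → x ⊥ ⊑ y ⊥ → x ≈ₚ y
  ⊥-injective x y x⊥⊑y⊥ = (λ m → point-⊑-sym y x y⊑x m) , y⊑x
    where
    y⊑x : ⟨ y ⟩ ⊑ ⟨ x ⟩
    y⊑x m = proj₁ (involutive ⟨ x ⟩) (antitone {x ⊥} {y ⊥} x⊥⊑y⊥ (proj₂ (involutive ⟨ y ⟩) m))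

  -- Sizes of polar planes and of their sections

  open ≡.≡-Reasoning

  #vectors-⊓-⊥ : ∀ U x k → #vectors U ≡ q ^ suc k → ¬ (U ⊑ x ⊥) → #vectors (U ⊓ x ⊥) ≡ q ^ k
  #vectors-⊓-⊥ U x k size U⋢x⊥ with v , v∈ , v∉ ← ⋢⇒witness U (x ⊥) U⋢x⊥ =
    cancel-q two≤q (trans (sym (#vectors-section (x ⊥) U v (⊥-isHyperplane x) v∈ v∉)) size)

  #vectors⇒#points : ∀ U {k n} → #vectors U ≡ k → k ≡ 1 + n * pred q → #points U ≡ n
  #vectors⇒#points U e f = cancel-pred two≤q (trans (sym (#vectors≡1+#points*[q-1] U)) (trans e f))

  #vectors-⊤ : #vectors ⊤ˢ ≡ q ^ 4
  #vectors-⊤ = FV.#-all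

  #vectors-⊥ : ∀ x → #vectors (x ⊥) ≡ q ^ 3
  #vectors-⊥ x = trans
    (FV.#-cong (mem? (x ⊥)) (mem? (⊤ˢ ⊓ x ⊥)) (λ _ m → _ , m) (λ _ → proj₂))
    (#vectors-⊓-⊥ ⊤ˢ x 3 #vectors-⊤ (λ f → ⊥-proper x f))

  #points-⊥ : ∀ x → #points (x ⊥) ≡ q ^ 2 + q + 1
  #points-⊥ x = #vectors⇒#points (x ⊥) (#vectors-⊥ x) (q^3-1-factor two≤q)

  #points-⊥⊓⊥ : ∀ x y → ¬ (x ≈ₚ y) → #points (x ⊥ ⊓ y ⊥) ≡ q + 1
  #points-⊥⊓⊥ x y x≉y = #vectors⇒#points (x ⊥ ⊓ y ⊥)
    (#vectors-⊓-⊥ (x ⊥) y 2 (#vectors-⊥ x) (λ f → x≉y (⊥-injective x y f))) (q^2-1-factor two≤q)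

  #points-line : ∀ L → #points ⟨ L ⟩ ≡ q + 1
  #points-line L = #vectors⇒#points ⟨ L ⟩ (#vectors-flat {2} L) (q^2-1-factor two≤q)

  -- A line outside `x ⊥` keeps `q` of its `q ^ 2` vectors, that is, one point; otherwise all
  -- `q + 1` points remain. The indicator merges both cases into a form that can be summed over
  -- lines.
  #points-line-⊓-⊥ : ∀ (L : Line) x → #points (⟨ L ⟩ ⊓ x ⊥) ≡ 1 + ⟦ L ⊑? x ⊥ ⟧ * q
  #points-line-⊓-⊥ L x with L ⊑? x ⊥
  ... | yes L⊑x⊥ = begin
    #points (⟨ L ⟩ ⊓ x ⊥) ≡⟨ FP.#-cong (_⊑? ⟨ L ⟩ ⊓ x ⊥) (_⊑? ⟨ L ⟩)
                               (λ z f {u} m → proj₁ (f m)) (λ z f {u} m → f m , L⊑x⊥ (f m)) ⟩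
    #points ⟨ L ⟩         ≡⟨ #points-line L ⟩
    q + 1                 ≡⟨ ℕ.+-comm q 1 ⟩
    1 + q                 ≡⟨ cong (1 +_) (ℕ.*-identityˡ q) ⟨
    1 + 1 * q             ∎
  ... | no L⋢x⊥ = #vectors⇒#points (⟨ L ⟩ ⊓ x ⊥)
    (trans (#vectors-⊓-⊥ ⟨ L ⟩ x 1 (#vectors-flat {2} L) L⋢x⊥) (ℕ.*-identityʳ q)) (q^1-1-factor two≤q)

  order : ℕ
  order = proj₁ points-finite

  order≡ : order ≡ (q ^ 2 + 1) * (q + 1)
  order≡ = trans (sym FP.#-all) (trans
    (FP.#-cong (λ x → yes x) (_⊑? ⊤ˢ) (λ x _ {u} _ → _) (λ x _ → x))
    (#vectors⇒#points ⊤ˢ #vectors-⊤ (q^4-1-factor two≤q)))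

-- Class sizes, degrees and common neighbours within a class are computed in doubled form; the
-- divisions by 2 in the parameters are therefore exact.
half : ∀ {m n} → m * 2 ≡ n → m ≡ n / 2
half {m} e = trans (sym (m*n/n≡m m 2)) (cong (_/ 2) e)

-- The spread and the graph

module Partition {c ℓ₁ ℓ₂ s p} (F : HeytingField c ℓ₁ ℓ₂) {q : ℕ} (sizeF : HasSize (PG3.scalars F) q)
    (ζ : PG3.SymplecticPolarity F)
    (S : Pred (PG3.Line F) s) (special : PG3.IsSpecialSpread F ζ S)
    (V₁ V₂ : Pred (PG3.Point F) p) (bip : IsBipartition (PG3.flats F 1) V₁ V₂)
    (V₁↔V₂ : Inverse (subsetoid (PG3.flats F 1) V₁) (subsetoid (PG3.flats F 1) V₂))
    (separates : PG3.SeparatesParts F ζ S V₁ V₂) where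
  open PG3 F hiding (_+_; _*_; Carrier; _≈_; 0#)
  open Geometry F sizeF
  open Symplectic F sizeF ζ
  open SymplecticPolarity ζ using (symplectic)
  open VecEq scalars using (≋-sym)
  open IsBipartition bip
  open IsSpecialSpread special using (isSpread; paired)
  open IsSpread isSpread using (covers)

  -- `V₁` and `V₂` come without decision procedures, so `cover` serves as one. Disjointness makes
  -- its choice agree with membership.
  class : Point → Fin 2
  class x with cover x
  ... | inj₁ _ = zero
  ... | inj₂ _ = suc zero

  V₁⇒class : ∀ x → V₁ x → class x ≡ zero
  V₁⇒class x v₁ with cover x
  ... | inj₁ _  = refl
  ... | inj₂ v₂ = contradiction (v₁ , v₂) (disjoint x)

  V₂⇒class : ∀ x → V₂ x → class x ≡ suc zero
  V₂⇒class x v₂ with cover x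
  ... | inj₁ v₁ = contradiction (v₁ , v₂) (disjoint x)
  ... | inj₂ _  = refl

  class⇒V₁ : ∀ x → class x ≡ zero → V₁ x
  class⇒V₁ x e with cover x
  ... | inj₁ v₁ = v₁
  class⇒V₁ x () | inj₂ _

  class⇒V₂ : ∀ x → class x ≡ suc zero → V₂ x
  class⇒V₂ x e with cover x
  ... | inj₂ v₂ = v₂
  class⇒V₂ x () | inj₁ _

  class-cong : ∀ {x y} → x ≈ₚ y → class x ≡ class y
  class-cong {x} {y} x≈y with cover x
  ... | inj₁ v₁ = sym (V₁⇒class y (respˡ x≈y v₁))
  ... | inj₂ v₂ = sym (V₂⇒class y (respʳ x≈y v₂))

  -- Lines of the spread and their partners

  line : Point → Line
  line x = proj₁ (covers x)

  line∈S : ∀ x → S (line x)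
  line∈S x = proj₁ (proj₁ (proj₂ (covers x)))

  on-line : ∀ x → x on line x
  on-line x = proj₂ (proj₁ (proj₂ (covers x)))

  line-unique : ∀ x L → S L → x on L → line x ≈ₗ L
  line-unique x L L∈S x∈L = proj₂ (proj₂ (covers x)) {L} (L∈S , λ {u} → x∈L {u})

  on-line-sym : ∀ x y → x on line y → y on line x
  on-line-sym x y x∈ m = proj₂ (line-unique x (line y) (line∈S y) (λ {u} → x∈ {u})) (on-line y m)

  -- Classes are compared with that of `x` instead of being named, so later counts need not
  -- distinguish whether `x` lies in `V₁` or in `V₂`.
  record Partner (x : Point) : Set (Level.suc (c ⊔ ℓ₁) ⊔ s) where
    field
      partner     : Line
      partner∈S   : S partner
      orthogonal  : OrthogonalLines ζ (line x) partner
      class-line  : ∀ y → y on line x → class y ≡ class x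
      class-other : ∀ y → y on partner → class y ≢ class x

    -- Orthogonality of lines speaks of points. A vector outside `x ⊥` is nonzero and hence spans a
    -- point of the partner, to which orthogonality applies.
    partner-⊑-⊥ : ⟨ partner ⟩ ⊑ x ⊥
    partner-⊑-⊥ {u} u∈ = decidable-stable (mem? (x ⊥) u) λ u∉ →
      let u≉0 = λ u≈0 → u∉ (mem-resp (x ⊥) (≋-sym u≈0) (Subspace.0-closed (x ⊥)))
      in u∉ (orthogonal x (point u u≉0) (λ {w} → on-line x {w})
              (λ {w} → point-⊑ (point u u≉0) ⟨ partner ⟩ u≉0 (∈-span u) u∈ {w}) (∈-span u))

  partnerOf : ∀ x → Partner x
  partnerOf x with paired (line x) (line∈S x)
  ... | M , (M∈S , ℓ⊥M) , _ with separates (line x) M (line∈S x) M∈S ℓ⊥M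
  ...   | inj₁ (ℓ⊆V₁ , M⊆V₂) = record
    { partner = M ; partner∈S = M∈S ; orthogonal = ℓ⊥M
    ; class-line  = λ y y∈ → trans (V₁⇒class y (ℓ⊆V₁ y y∈)) (sym class-x)
    ; class-other = λ y y∈ e → case trans (sym (V₂⇒class y (M⊆V₂ y y∈))) (trans e class-x) of λ ()
    }
    where class-x = V₁⇒class x (ℓ⊆V₁ x (λ {u} → on-line x {u}))
  ...   | inj₂ (ℓ⊆V₂ , M⊆V₁) = record
    { partner = M ; partner∈S = M∈S ; orthogonal = ℓ⊥M
    ; class-line  = λ y y∈ → trans (V₂⇒class y (ℓ⊆V₂ y y∈)) (sym class-x)
    ; class-other = λ y y∈ e → case trans (sym (V₁⇒class y (M⊆V₁ y y∈))) (trans e class-x) of λ ()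
    }
    where class-x = V₂⇒class x (ℓ⊆V₂ x (λ {u} → on-line x {u}))

  class-line : ∀ x y → y on line x → class y ≡ class x
  class-line x = Partner.class-line (partnerOf x)

  sizeP : HasSize (flats 1) order
  sizeP = proj₂ points-finite

  -- Counting the pairs (z , w) with z in Q, w in x ⊥ and both on a common line of S.
  spread-count : ∀ {r} {Q : Pred Point r} (Q? : Decidable Q) →
                 (∀ z w → w on line z → Q z → Q w) → ∀ x →
                 FP.# (λ w → Q? w ×-dec (w ⊑? x ⊥)) * (q + 1) ≡
                 FP.# Q? + FP.# (λ z → Q? z ×-dec (line z ⊑? x ⊥)) * q
  spread-count {Q = Q} Q? saturated x = sym (begin
    FP.# Q? + FP.# (λ z → Q? z ×-dec (line z ⊑? x ⊥)) * q
      ≡⟨ cong (FP.# Q? +_) (FP.∑-*ʳ (λ z → ⟦ Q? z ×-dec (line z ⊑? x ⊥) ⟧) q) ⟨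
    FP.# Q? + FP.∑ (λ z → ⟦ Q? z ×-dec (line z ⊑? x ⊥) ⟧ * q)
      ≡⟨ FP.∑-+ (λ z → ⟦ Q? z ⟧) (λ z → ⟦ Q? z ×-dec (line z ⊑? x ⊥) ⟧ * q) ⟨
    FP.∑ (λ z → ⟦ Q? z ⟧ + ⟦ Q? z ×-dec (line z ⊑? x ⊥) ⟧ * q)
      ≡⟨ FP.∑-cong (λ z → factor (Q? z) (line z ⊑? x ⊥)) ⟩
    FP.∑ (λ z → ⟦ Q? z ⟧ * (1 + ⟦ line z ⊑? x ⊥ ⟧ * q))
      ≡⟨ FP.∑-cong (λ z → FP.#-guard (Q? z) (_⊑? ⟨ line z ⟩ ⊓ x ⊥) λ _ → #points-line-⊓-⊥ (line z) x) ⟨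
    FP.∑ (λ z → FP.# (λ w → Q? z ×-dec (w ⊑? ⟨ line z ⟩ ⊓ x ⊥)))
      ≡⟨ double-count sizeP sizeP (λ z w → Q? z ×-dec (w ⊑? ⟨ line z ⟩ ⊓ x ⊥)) ⟩
    FP.∑ (λ w → FP.# (λ z → Q? z ×-dec (w ⊑? ⟨ line z ⟩ ⊓ x ⊥)))
      -- Lying on a common line of `S` is symmetric, and `Q` is constant along such lines. For fixed
      -- `w` the condition on `z` is thus only to lie on `line w`, which has `q + 1` points.
      ≡⟨ FP.∑-cong (λ w → FP.#-cong (λ z → Q? z ×-dec (w ⊑? ⟨ line z ⟩ ⊓ x ⊥))
           (λ z → (Q? w ×-dec (w ⊑? x ⊥)) ×-dec (z ⊑? ⟨ line w ⟩))
           (λ z (Qz , w∈) → (saturated z w (λ m → proj₁ (w∈ m)) Qz , λ m → proj₂ (w∈ m))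
                          , λ {u} → on-line-sym w z (λ m → proj₁ (w∈ m)) {u})
           (λ z ((Qw , w∈x⊥) , z∈) → saturated w z z∈ Qw
                          , λ m → on-line-sym z w z∈ m , w∈x⊥ m)) ⟩
    FP.∑ (λ w → FP.# (λ z → (Q? w ×-dec (w ⊑? x ⊥)) ×-dec (z ⊑? ⟨ line w ⟩)))
      ≡⟨ FP.∑-cong (λ w → FP.#-guard (Q? w ×-dec (w ⊑? x ⊥)) (_⊑? ⟨ line w ⟩) λ _ → #points-line (line w)) ⟩
    FP.∑ (λ w → ⟦ Q? w ×-dec (w ⊑? x ⊥) ⟧ * (q + 1))
      ≡⟨ FP.∑-*ʳ (λ w → ⟦ Q? w ×-dec (w ⊑? x ⊥) ⟧) (q + 1) ⟩
    FP.# (λ w → Q? w ×-dec (w ⊑? x ⊥)) * (q + 1) ∎)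
    where
    open ≡.≡-Reasoning
    factor : ∀ {a b} {A : Set a} {B : Set b} (A? : Dec A) (B? : Dec B) →
             ⟦ A? ⟧ + ⟦ A? ×-dec B? ⟧ * q ≡ ⟦ A? ⟧ * (1 + ⟦ B? ⟧ * q)
    factor (yes _) B? = sym (ℕ.+-identityʳ _)
    factor (no _)  B? = refl

  -- Distribution of a polar plane over the two classes

  sameClass? : ∀ x → Decidable (λ z → class z ≡ class x)
  sameClass? x z = class z Fin.≟ class x

  -- Only the line paired with the one through x lies in x ⊥, and it lies in
  -- the other class.
  no-same-line : ∀ x → FP.# (λ z → sameClass? x z ×-dec (line z ⊑? x ⊥)) ≡ 0
  no-same-line x = ℕ.n≤0⇒n≡0 (ℕ.+-cancelʳ-≤ (q + 1) _ 0 (begin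
    FP.# same + (q + 1)     ≤⟨ ℕ.+-monoʳ-≤ (FP.# same) partner-points ⟩
    FP.# same + FP.# other  ≡⟨ FP.#-split (λ z → line z ⊑? x ⊥) (sameClass? x) ⟨
    FP.# (λ z → line z ⊑? x ⊥) ≡⟨ #lines≡q+1 ⟩
    q + 1                   ∎))
    where
    open ℕ.≤-Reasoning
    open Partner (partnerOf x)
    same  = λ z → sameClass? x z ×-dec (line z ⊑? x ⊥)
    other = λ z → ¬? (sameClass? x z) ×-dec (line z ⊑? x ⊥)

    partner-points : q + 1 ℕ.≤ FP.# other
    partner-points = begin
      q + 1                    ≡⟨ #points-line partner ⟨
      FP.# (_⊑? ⟨ partner ⟩)   ≤⟨ FP.#-mono (_⊑? ⟨ partner ⟩) other (λ z z∈ → class-other z z∈ ,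
                                    λ m → partner-⊑-⊥ (proj₁ (line-unique z partner partner∈S z∈) m)) ⟩
      FP.# other               ∎

    #lines≡q+1 : FP.# (λ z → line z ⊑? x ⊥) ≡ q + 1
    #lines≡q+1 = cancel-q two≤q (ℕ.+-cancelˡ-≡ ((q ^ 2 + 1) * (q + 1)) _ _ (begin-equality
      (q ^ 2 + 1) * (q + 1) + q * FP.# (λ z → line z ⊑? x ⊥)
        ≡⟨ cong₂ _+_ (trans (sym order≡) (sym FP.#-all)) (ℕ.*-comm q _) ⟩
      FP.# (λ z → yes z) + FP.# (λ z → line z ⊑? x ⊥) * q
        ≡⟨ spread-count (λ z → yes z) (λ _ w _ _ → w) x ⟨
      #points (x ⊥) * (q + 1)
        ≡⟨ cong (_* (q + 1)) (#points-⊥ x) ⟩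
      (q ^ 2 + q + 1) * (q + 1)
        ≡⟨ identity q ⟩
      (q ^ 2 + 1) * (q + 1) + q * (q + 1) ∎))
      where
      identity : ∀ q → (q * (q * 1) + q + 1) * (q + 1) ≡ (q * (q * 1) + 1) * (q + 1) + q * (q + 1)
      identity = solve-∀

  #V₁≡#V₂ : FP.# (λ z → class z Fin.≟ zero) ≡ FP.# (λ z → class z Fin.≟ suc zero)
  #V₁≡#V₂ = FP.#-size (λ z → class z Fin.≟ zero) (λ x≈y e → trans (sym (class-cong x≈y)) e)
    (iso ⨾ FP.subset-size (λ z → class z Fin.≟ suc zero) (λ x≈y e → trans (sym (class-cong x≈y)) e))
    where
    open Inverse V₁↔V₂
    iso : Inverse (subsetoid (flats 1) (λ z → class z ≡ zero)) (subsetoid (flats 1) (λ z → class z ≡ suc zero))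
    iso = record
      { to        = λ (x , e) → let (y , v₂) = to (x , class⇒V₁ x e) in y , V₂⇒class y v₂
      ; from      = λ (y , e) → let (x , v₁) = from (y , class⇒V₂ y e) in x , V₁⇒class x v₁
      ; to-cong   = λ {a} {b} → to-cong {_ , class⇒V₁ _ (proj₂ a)} {_ , class⇒V₁ _ (proj₂ b)}
      ; from-cong = λ {a} {b} → from-cong {_ , class⇒V₂ _ (proj₂ a)} {_ , class⇒V₂ _ (proj₂ b)}
      ; inverse   = (λ {b} {a} → inverseˡ {_ , class⇒V₂ _ (proj₂ b)} {_ , class⇒V₁ _ (proj₂ a)})
                  , (λ {a} {b} → inverseʳ {_ , class⇒V₁ _ (proj₂ a)} {_ , class⇒V₂ _ (proj₂ b)})
      }

  #class : ∀ i → FP.# (λ z → class z Fin.≟ i) * 2 ≡ (q ^ 2 + 1) * (q + 1)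
  #class i = trans (twice i) (trans (sym #V₁+#V₂) order≡)
    where
    #V₁+#V₂ : order ≡ FP.# (λ z → class z Fin.≟ zero) + FP.# (λ z → class z Fin.≟ suc zero)
    #V₁+#V₂ = trans (sym FP.#-all) (trans (FP.#-split (λ z → yes z) (λ z → class z Fin.≟ zero)) (cong₂ _+_
      (FP.#-cong (λ z → (class z Fin.≟ zero) ×-dec yes z) (λ z → class z Fin.≟ zero) (λ _ → proj₁) (λ z e → e , z))
      (FP.#-cong (λ z → ¬? (class z Fin.≟ zero) ×-dec yes z) (λ z → class z Fin.≟ suc zero)
        (λ z (e≢0 , _) → nonzero⇒one (class z) e≢0) (λ z e → (λ e≡0 → case trans (sym e) e≡0 of λ ()) , z))))
      where
      nonzero⇒one : ∀ (i : Fin 2) → i ≢ zero → i ≡ suc zero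
      nonzero⇒one zero       i≢0 = contradiction refl i≢0
      nonzero⇒one (suc zero) _   = refl

    double : ∀ n → n * 2 ≡ n + n
    double = solve-∀

    n₁ n₂ : ℕ
    n₁ = FP.# (λ z → class z Fin.≟ zero)
    n₂ = FP.# (λ z → class z Fin.≟ suc zero)

    twice : ∀ i → FP.# (λ z → class z Fin.≟ i) * 2 ≡ n₁ + n₂
    twice zero       = trans (double n₁) (cong (n₁ +_) #V₁≡#V₂)
    twice (suc zero) = trans (double n₂) (cong (_+ n₂) (sym #V₁≡#V₂))

  same-⊥? : ∀ x → Decidable (λ z → class z ≡ class x × ⟨ z ⟩ ⊑ x ⊥)
  same-⊥? x z = sameClass? x z ×-dec (z ⊑? x ⊥)

  other-⊥? : ∀ x → Decidable (λ z → class z ≢ class x × ⟨ z ⟩ ⊑ x ⊥)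
  other-⊥? x z = ¬? (sameClass? x z) ×-dec (z ⊑? x ⊥)

  -- The class of `x` is a union of lines of `S`, none of which lies in `x ⊥`. Each therefore meets
  -- `x ⊥` in one of its `q + 1` points, which is `spread-count` with vanishing last term.
  #same-⊥ : ∀ x → FP.# (same-⊥? x) * 2 ≡ q ^ 2 + 1
  #same-⊥ x = ℕ.*-cancelʳ-≡ _ _ (suc q) (begin
    A * 2 * suc q             ≡⟨ identity A q ⟩
    A * (q + 1) * 2           ≡⟨ cong (_* 2) (spread-count (sameClass? x)
                                   (λ z w w∈ e → trans (class-line z w w∈) e) x) ⟩
    (N + FP.# (λ z → sameClass? x z ×-dec (line z ⊑? x ⊥)) * q) * 2
                              ≡⟨ cong (λ t → (N + t * q) * 2) (no-same-line x) ⟩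
    (N + 0) * 2               ≡⟨ cong (_* 2) (ℕ.+-identityʳ N) ⟩
    N * 2                     ≡⟨ #class (class x) ⟩
    (q ^ 2 + 1) * (q + 1)     ≡⟨ cong ((q ^ 2 + 1) *_) (ℕ.+-comm q 1) ⟩
    (q ^ 2 + 1) * suc q       ∎)
    where
    open ≡.≡-Reasoning
    A = FP.# (same-⊥? x)
    N = FP.# (sameClass? x)
    identity : ∀ A q → A * 2 * (1 + q) ≡ A * (q + 1) * 2
    identity = solve-∀

  #same+#other-⊥ : ∀ x → FP.# (same-⊥? x) + FP.# (other-⊥? x) ≡ q ^ 2 + q + 1
  #same+#other-⊥ x = trans (sym (FP.#-split (_⊑? x ⊥) (sameClass? x))) (#points-⊥ x)

  #other-⊥ : ∀ x → FP.# (other-⊥? x) * 2 ≡ q ^ 2 + 2 * q + 1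
  #other-⊥ x = ℕ.+-cancelˡ-≡ (q ^ 2 + 1) _ _ (begin
    q ^ 2 + 1 + B * 2                ≡⟨ cong (_+ B * 2) (#same-⊥ x) ⟨
    A * 2 + B * 2                    ≡⟨ ℕ.*-distribʳ-+ 2 A B ⟨
    (A + B) * 2                      ≡⟨ cong (_* 2) (#same+#other-⊥ x) ⟩
    (q ^ 2 + q + 1) * 2              ≡⟨ identity q ⟩
    q ^ 2 + 1 + (q ^ 2 + 2 * q + 1)  ∎)
    where
    open ≡.≡-Reasoning
    A = FP.# (same-⊥? x)
    B = FP.# (other-⊥? x)
    identity : ∀ q → (q * (q * 1) + q + 1) * 2 ≡ q * (q * 1) + 1 + (q * (q * 1) + 2 * q + 1)
    identity = solve-∀

  -- Adjacency in the new graph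

  Γ : Graph _ _ _
  Γ = Γ′ ζ bip

  open Graph Γ using (_~_; ~-resp)

  -- Unfolds the nested complementations: the outer one acts inside `V₂`, the inner one inside `V₁`,
  -- and what remains are the edges of `Sp4` between the classes. `¬~₁` denies adjacency after the
  -- inner complementation, `¬~₀` denies it in `Sp4`.
  ~⇒ : ∀ x z → x ~ z → (class z ≡ class x × ¬ (⟨ z ⟩ ⊑ x ⊥)) ⊎ (class z ≢ class x × ⟨ z ⟩ ⊑ x ⊥)
  ~⇒ x z (inj₁ ((x∈V₂ , z∈V₂) , x≉z , ¬~₁)) = inj₁
    ( trans (V₂⇒class z z∈V₂) (sym (V₂⇒class x x∈V₂))
    , λ x⊥z → ¬~₁ (inj₂ ((λ (x∈V₁ , _) → disjoint x (x∈V₁ , x∈V₂)) , x≉z , x⊥z)))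
  ~⇒ x z (inj₂ (_ , inj₁ ((x∈V₁ , z∈V₁) , x≉z , ¬~₀))) = inj₁
    ( trans (V₁⇒class z z∈V₁) (sym (V₁⇒class x x∈V₁))
    , λ x⊥z → ¬~₀ (x≉z , x⊥z))
  ~⇒ x z (inj₂ (¬V₂ , inj₂ (¬V₁ , _ , x⊥z))) = inj₂ (different , x⊥z)
    where
    different : class z ≢ class x
    different e with cover x
    ... | inj₁ x∈V₁ = ¬V₁ (x∈V₁ , class⇒V₁ z e)
    ... | inj₂ x∈V₂ = ¬V₂ (x∈V₂ , class⇒V₂ z e)

  ~⇐ : ∀ x z → (class z ≡ class x × ¬ (⟨ z ⟩ ⊑ x ⊥)) ⊎ (class z ≢ class x × ⟨ z ⟩ ⊑ x ⊥) → x ~ z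
  ~⇐ x z (inj₁ (e , ¬x⊥z)) with cover x
  ... | inj₁ x∈V₁ = inj₂ ( (λ (x∈V₂ , _) → disjoint x (x∈V₁ , x∈V₂))
                         , inj₁ ((x∈V₁ , class⇒V₁ z e) , x≉z , λ (_ , x⊥z) → ¬x⊥z x⊥z))
    where
    -- The polarity is symplectic, so `x` lies in `x ⊥`; a point not orthogonal to `x` differs from
    -- `x`.
    x≉z : ¬ (x ≈ₚ z)
    x≉z x≈z = ¬x⊥z λ m → symplectic x (proj₂ x≈z m)
  ... | inj₂ x∈V₂ = inj₁ ((x∈V₂ , class⇒V₂ z e) , x≉z , λ
      { (inj₁ ((x∈V₁ , _) , _)) → disjoint x (x∈V₁ , x∈V₂)
      ; (inj₂ (_ , _ , x⊥z))    → ¬x⊥z x⊥z })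
    where
    x≉z : ¬ (x ≈ₚ z)
    x≉z x≈z = ¬x⊥z λ m → symplectic x (proj₂ x≈z m)
  ~⇐ x z (inj₂ (different , x⊥z)) = inj₂
    ( (λ (x∈V₂ , z∈V₂) → different (trans (V₂⇒class z z∈V₂) (sym (V₂⇒class x x∈V₂))))
    , inj₂ ( (λ (x∈V₁ , z∈V₁) → different (trans (V₁⇒class z z∈V₁) (sym (V₁⇒class x x∈V₁))))
           , (λ x≈z → different (sym (class-cong x≈z)))
           , x⊥z))

  -- Going through `map′` makes the indicator of adjacency that of the two-case description, which
  -- the pointwise identities below can analyse.
  ~? : ∀ x → Decidable (x ~_)
  ~? x z = map′ (~⇐ x z) (~⇒ x z)
    ((sameClass? x z ×-dec ¬? (z ⊑? x ⊥)) ⊎-dec (¬? (sameClass? x z) ×-dec (z ⊑? x ⊥)))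

  -- Degrees and numbers of common neighbours

  common? : ∀ x y → Decidable (λ z → x ~ z × y ~ z)
  common? x y z = ~? x z ×-dec ~? y z

  -- The counts follow from identities between indicator functions, with the terms
  -- moved so that no subtraction occurs.
  degree-count : ∀ x → FP.# (~? x) + FP.# (same-⊥? x) ≡ FP.# (sameClass? x) + FP.# (other-⊥? x)
  degree-count x = begin
    FP.# (~? x) + FP.# (same-⊥? x)
      ≡⟨ FP.∑-+ (λ z → ⟦ ~? x z ⟧) (λ z → ⟦ same-⊥? x z ⟧) ⟨
    FP.∑ (λ z → ⟦ ~? x z ⟧ + ⟦ same-⊥? x z ⟧)
      ≡⟨ FP.∑-cong (λ z → pointwise (sameClass? x z) (z ⊑? x ⊥)) ⟩
    FP.∑ (λ z → ⟦ sameClass? x z ⟧ + ⟦ other-⊥? x z ⟧)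
      ≡⟨ FP.∑-+ (λ z → ⟦ sameClass? x z ⟧) (λ z → ⟦ other-⊥? x z ⟧) ⟩
    FP.# (sameClass? x) + FP.# (other-⊥? x) ∎
    where
    open ≡.≡-Reasoning
    pointwise : ∀ {a b} {A : Set a} {B : Set b} (A? : Dec A) (B? : Dec B) →
                ⟦ (A? ×-dec ¬? B?) ⊎-dec (¬? A? ×-dec B?) ⟧ + ⟦ A? ×-dec B? ⟧ ≡ ⟦ A? ⟧ + ⟦ ¬? A? ×-dec B? ⟧
    pointwise (yes _) (yes _) = refl
    pointwise (yes _) (no _)  = refl
    pointwise (no _)  (yes _) = refl
    pointwise (no _)  (no _)  = refl

  degree : ∀ x → FP.# (~? x) ≡ (q ^ 3 + q ^ 2 + 3 * q + 1) / 2
  degree x = half (ℕ.+-cancelʳ-≡ (q ^ 2 + 1) (D * 2) (q ^ 3 + q ^ 2 + 3 * q + 1) (begin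
    D * 2 + (q ^ 2 + 1)                            ≡⟨ cong (D * 2 +_) (#same-⊥ x) ⟨
    D * 2 + A * 2                                  ≡⟨ ℕ.*-distribʳ-+ 2 D A ⟨
    (D + A) * 2                                    ≡⟨ cong (_* 2) (degree-count x) ⟩
    (N + B) * 2                                    ≡⟨ ℕ.*-distribʳ-+ 2 N B ⟩
    N * 2 + B * 2                                  ≡⟨ cong₂ _+_ (#class (class x)) (#other-⊥ x) ⟩
    (q ^ 2 + 1) * (q + 1) + (q ^ 2 + 2 * q + 1)    ≡⟨ identity q ⟩
    q ^ 3 + q ^ 2 + 3 * q + 1 + (q ^ 2 + 1)        ∎))
    where
    open ≡.≡-Reasoning
    D = FP.# (~? x)
    A = FP.# (same-⊥? x)
    B = FP.# (other-⊥? x)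
    N = FP.# (sameClass? x)
    identity : ∀ q → (q * (q * 1) + 1) * (q + 1) + (q * (q * 1) + 2 * q + 1) ≡
                     q * (q * (q * 1)) + q * (q * 1) + 3 * q + 1 + (q * (q * 1) + 1)
    identity = solve-∀

  bothOrthogonal? : ∀ x y → Decidable (λ (z : Point) → ⟨ z ⟩ ⊑ x ⊥ × ⟨ z ⟩ ⊑ y ⊥)
  bothOrthogonal? x y z = (z ⊑? x ⊥) ×-dec (z ⊑? y ⊥)

  #bothOrthogonal : ∀ x y → ¬ (x ≈ₚ y) → FP.# (bothOrthogonal? x y) ≡ q + 1
  #bothOrthogonal x y x≉y = trans
    (FP.#-cong (bothOrthogonal? x y) (_⊑? x ⊥ ⊓ y ⊥)
      (λ z (x⊥z , y⊥z) m → x⊥z m , y⊥z m)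
      (λ z f → (λ m → proj₁ (f m)) , λ m → proj₂ (f m)))
    (#points-⊥⊓⊥ x y x≉y)

  -- Within the class of `x` and `y` a common neighbour is orthogonal to neither of them, outside it
  -- to both. Inclusion-exclusion inside adds the points orthogonal to both there, so only their
  -- total number over both classes enters.
  common-same-count : ∀ x y → class x ≡ class y →
    FP.# (common? x y) + (FP.# (same-⊥? x) + FP.# (same-⊥? y)) ≡
    FP.# (sameClass? x) + FP.# (bothOrthogonal? x y)
  common-same-count x y x~y = begin
    FP.# (common? x y) + (FP.# (same-⊥? x) + FP.# (same-⊥? y))
      ≡⟨ cong (FP.# (common? x y) +_) (FP.∑-+ (λ z → ⟦ same-⊥? x z ⟧) (λ z → ⟦ same-⊥? y z ⟧)) ⟨
    FP.# (common? x y) + FP.∑ (λ z → ⟦ same-⊥? x z ⟧ + ⟦ same-⊥? y z ⟧)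
      ≡⟨ FP.∑-+ (λ z → ⟦ common? x y z ⟧) (λ z → ⟦ same-⊥? x z ⟧ + ⟦ same-⊥? y z ⟧) ⟨
    FP.∑ (λ z → ⟦ common? x y z ⟧ + (⟦ same-⊥? x z ⟧ + ⟦ same-⊥? y z ⟧))
      ≡⟨ FP.∑-cong (λ z → pointwise (sameClass? x z) (sameClass? y z) (z ⊑? x ⊥) (z ⊑? y ⊥)
           (λ e → trans e x~y) (λ e → trans e (sym x~y))) ⟩
    FP.∑ (λ z → ⟦ sameClass? x z ⟧ + ⟦ bothOrthogonal? x y z ⟧)
      ≡⟨ FP.∑-+ (λ z → ⟦ sameClass? x z ⟧) (λ z → ⟦ bothOrthogonal? x y z ⟧) ⟩
    FP.# (sameClass? x) + FP.# (bothOrthogonal? x y) ∎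
    where
    open ≡.≡-Reasoning
    pointwise : ∀ {a b c d} {A : Set a} {B : Set b} {C : Set c} {D : Set d}
                (A? : Dec A) (B? : Dec B) (C? : Dec C) (D? : Dec D) → (A → B) → (B → A) →
                ⟦ ((A? ×-dec ¬? C?) ⊎-dec (¬? A? ×-dec C?)) ×-dec ((B? ×-dec ¬? D?) ⊎-dec (¬? B? ×-dec D?)) ⟧
                  + (⟦ A? ×-dec C? ⟧ + ⟦ B? ×-dec D? ⟧)
                ≡ ⟦ A? ⟧ + ⟦ C? ×-dec D? ⟧
    pointwise (yes x) (no ¬y) _       _       f g = contradiction (f x) ¬y
    pointwise (no ¬x) (yes y) _       _       f g = contradiction (g y) ¬x
    pointwise (yes _) (yes _) (yes _) (yes _) f g = refl
    pointwise (yes _) (yes _) (yes _) (no _)  f g = refl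
    pointwise (yes _) (yes _) (no _)  (yes _) f g = refl
    pointwise (yes _) (yes _) (no _)  (no _)  f g = refl
    pointwise (no _)  (no _)  (yes _) (yes _) f g = refl
    pointwise (no _)  (no _)  (yes _) (no _)  f g = refl
    pointwise (no _)  (no _)  (no _)  (yes _) f g = refl
    pointwise (no _)  (no _)  (no _)  (no _)  f g = refl

  #common-same : ∀ x y → ¬ (x ≈ₚ y) → class x ≡ class y →
                 FP.# (common? x y) ≡ (q ^ 3 ∸ q ^ 2 + 3 * q + 1) / 2
  #common-same x y x≉y x~y = half (ℕ.+-cancelʳ-≡ ((q ^ 2 + 1) + (q ^ 2 + 1)) (C * 2)
      (q ^ 3 ∸ q ^ 2 + 3 * q + 1) (begin
    C * 2 + ((q ^ 2 + 1) + (q ^ 2 + 1))            ≡⟨ cong (C * 2 +_) (cong₂ _+_ (#same-⊥ x) (#same-⊥ y)) ⟨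
    C * 2 + (A * 2 + A′ * 2)                       ≡⟨ identity₁ C A A′ ⟩
    (C + (A + A′)) * 2                             ≡⟨ cong (_* 2) (common-same-count x y x~y) ⟩
    (N + FP.# (bothOrthogonal? x y)) * 2           ≡⟨ cong (λ t → (N + t) * 2) (#bothOrthogonal x y x≉y) ⟩
    (N + (q + 1)) * 2                              ≡⟨ ℕ.*-distribʳ-+ 2 N (q + 1) ⟩
    N * 2 + (q + 1) * 2                            ≡⟨ cong (_+ (q + 1) * 2) (#class (class x)) ⟩
    (q ^ 2 + 1) * (q + 1) + (q + 1) * 2            ≡⟨ identity₂ q ⟩
    -- The truncated subtraction is exact because `q ^ 2` is at most `q ^ 3`.
    q ^ 3 + (q ^ 2 + (3 * q + 3))                  ≡⟨ cong (_+ (q ^ 2 + (3 * q + 3))) (ℕ.m∸n+n≡m q²≤q³) ⟨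
    q ^ 3 ∸ q ^ 2 + q ^ 2 + (q ^ 2 + (3 * q + 3))  ≡⟨ identity₃ (q ^ 3 ∸ q ^ 2) (q ^ 2) q ⟩
    q ^ 3 ∸ q ^ 2 + 3 * q + 1 + ((q ^ 2 + 1) + (q ^ 2 + 1)) ∎))
    where
    open ≡.≡-Reasoning
    C = FP.# (common? x y)
    A = FP.# (same-⊥? x)
    A′ = FP.# (same-⊥? y)
    N = FP.# (sameClass? x)

    q²≤q³ : q ^ 2 ℕ.≤ q ^ 3
    -- For `q` of the form `2 + r`, the product `q ^ 3` unfolds to `q ^ 2` plus a remainder.
    q²≤q³ with r , e ← two≤q = subst (λ n → n ^ 2 ℕ.≤ n ^ 3) (sym e) (ℕ.m≤m+n ((2 + r) ^ 2) _)

    identity₁ : ∀ C A A′ → C * 2 + (A * 2 + A′ * 2) ≡ (C + (A + A′)) * 2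
    identity₁ = solve-∀
    identity₂ : ∀ q → (q * (q * 1) + 1) * (q + 1) + (q + 1) * 2 ≡ q * (q * (q * 1)) + (q * (q * 1) + (3 * q + 3))
    identity₂ = solve-∀
    identity₃ : ∀ d s q → d + s + (s + (3 * q + 3)) ≡ d + 3 * q + 1 + ((s + 1) + (s + 1))
    identity₃ = solve-∀

  -- Every `z` shares its class with exactly one of `x` and `y`, and is a common neighbour when
  -- orthogonal to the other one only. Adding the points orthogonal to both leaves, in each class,
  -- the points orthogonal to the vertex outside that class.
  common-different-count : ∀ x y → class x ≢ class y →
    FP.# (common? x y) + FP.# (bothOrthogonal? x y) ≡ FP.# (other-⊥? x) + FP.# (other-⊥? y)
  common-different-count x y x≁y = begin
    FP.# (common? x y) + FP.# (bothOrthogonal? x y)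
      ≡⟨ FP.∑-+ (λ z → ⟦ common? x y z ⟧) (λ z → ⟦ bothOrthogonal? x y z ⟧) ⟨
    FP.∑ (λ z → ⟦ common? x y z ⟧ + ⟦ bothOrthogonal? x y z ⟧)
      ≡⟨ FP.∑-cong (λ z → pointwise (sameClass? x z) (sameClass? y z) (z ⊑? x ⊥) (z ⊑? y ⊥)
           (λ e f → x≁y (trans (sym e) f)) (third (class x) (class y) (class z) x≁y)) ⟩
    FP.∑ (λ z → ⟦ other-⊥? x z ⟧ + ⟦ other-⊥? y z ⟧)
      ≡⟨ FP.∑-+ (λ z → ⟦ other-⊥? x z ⟧) (λ z → ⟦ other-⊥? y z ⟧) ⟩
    FP.# (other-⊥? x) + FP.# (other-⊥? y) ∎
    where
    open ≡.≡-Reasoning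
    third : ∀ (i j k : Fin 2) → i ≢ j → k ≢ i → k ≡ j
    third zero       zero       _          i≢j _   = contradiction refl i≢j
    third zero       (suc zero) zero       _   k≢i = contradiction refl k≢i
    third zero       (suc zero) (suc zero) _   _   = refl
    third (suc zero) zero       zero       _   _   = refl
    third (suc zero) zero       (suc zero) _   k≢i = contradiction refl k≢i
    third (suc zero) (suc zero) _          i≢j _   = contradiction refl i≢j

    pointwise : ∀ {a b c d} {A : Set a} {B : Set b} {C : Set c} {D : Set d}
                (A? : Dec A) (B? : Dec B) (C? : Dec C) (D? : Dec D) → (A → ¬ B) → (¬ A → B) →
                ⟦ ((A? ×-dec ¬? C?) ⊎-dec (¬? A? ×-dec C?)) ×-dec ((B? ×-dec ¬? D?) ⊎-dec (¬? B? ×-dec D?)) ⟧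
                  + ⟦ C? ×-dec D? ⟧
                ≡ ⟦ ¬? A? ×-dec C? ⟧ + ⟦ ¬? B? ×-dec D? ⟧
    pointwise (yes x) (yes y) _       _       f g = contradiction y (f x)
    pointwise (no ¬x) (no ¬y) _       _       f g = contradiction (g ¬x) ¬y
    pointwise (yes _) (no _)  (yes _) (yes _) f g = refl
    pointwise (yes _) (no _)  (yes _) (no _)  f g = refl
    pointwise (yes _) (no _)  (no _)  (yes _) f g = refl
    pointwise (yes _) (no _)  (no _)  (no _)  f g = refl
    pointwise (no _)  (yes _) (yes _) (yes _) f g = refl
    pointwise (no _)  (yes _) (yes _) (no _)  f g = refl
    pointwise (no _)  (yes _) (no _)  (yes _) f g = refl
    pointwise (no _)  (yes _) (no _)  (no _)  f g = refl

  #common-different : ∀ x y → class x ≢ class y → FP.# (common? x y) ≡ q ^ 2 + q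
  #common-different x y x≁y = ℕ.*-cancelʳ-≡ C (q ^ 2 + q) 2 (ℕ.+-cancelʳ-≡ ((q + 1) * 2) _ _ (begin
    C * 2 + (q + 1) * 2                            ≡⟨ ℕ.*-distribʳ-+ 2 C (q + 1) ⟨
    (C + (q + 1)) * 2                              ≡⟨ cong (λ t → (C + t) * 2)
                                                         (#bothOrthogonal x y (λ x≈y → x≁y (class-cong x≈y))) ⟨
    (C + FP.# (bothOrthogonal? x y)) * 2           ≡⟨ cong (_* 2) (common-different-count x y x≁y) ⟩
    (B + B′) * 2                                   ≡⟨ ℕ.*-distribʳ-+ 2 B B′ ⟩
    B * 2 + B′ * 2                                 ≡⟨ cong₂ _+_ (#other-⊥ x) (#other-⊥ y) ⟩
    q ^ 2 + 2 * q + 1 + (q ^ 2 + 2 * q + 1)        ≡⟨ identity q ⟩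
    (q ^ 2 + q) * 2 + (q + 1) * 2                  ∎))
    where
    open ≡.≡-Reasoning
    C = FP.# (common? x y)
    B = FP.# (other-⊥? x)
    B′ = FP.# (other-⊥? y)
    identity : ∀ q → q * (q * 1) + 2 * q + 1 + (q * (q * 1) + 2 * q + 1) ≡ (q * (q * 1) + q) * 2 + (q + 1) * 2
    identity = solve-∀

  -- Assembling the parameters

  isDivisibleDesignGraph : IsDivisibleDesignGraph Γ
    ((q ^ 2 + 1) * (q + 1))
    ((q ^ 3 + q ^ 2 + 3 * q + 1) / 2)
    ((q ^ 3 ∸ q ^ 2 + 3 * q + 1) / 2)
    (q ^ 2 + q)
    2
    (((q ^ 2 + 1) * (q + 1)) / 2)
  isDivisibleDesignGraph = record
    { order     = subst (HasSize (flats 1)) order≡ sizeP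
    ; regular   = λ x → subst (HasSize _) (degree x) (FP.subset-size (~? x) (~-respʳ x))
    ; partition = record { to = class ; cong = class-cong }
    ; classSize = λ i → subst (HasSize _) (class-size i)
        (FP.subset-size (λ z → class z Fin.≟ i) (λ x≈y e → trans (sym (class-cong x≈y)) e))
    ; sameClass = λ x y x≉y x~y → subst (HasSize _) (#common-same x y x≉y x~y)
        (FP.subset-size (common? x y) (common-resp x y))
    ; diffClass = λ x y x≁y → subst (HasSize _) (#common-different x y x≁y)
        (FP.subset-size (common? x y) (common-resp x y))
    }
    where
    ~-respʳ : ∀ x → (x ~_) Respects _≈ₚ_
    ~-respʳ x = ~-resp (Setoid.refl (flats 1) {x})

    common-resp : ∀ x y → (λ z → x ~ z × y ~ z) Respects _≈ₚ_
    common-resp x y z≈w (x~z , y~z) = ~-respʳ x z≈w x~z , ~-respʳ y z≈w y~z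

    class-size : ∀ i → FP.# (λ z → class z Fin.≟ i) ≡ ((q ^ 2 + 1) * (q + 1)) / 2
    class-size i = half (#class i)

theorem2 : ∀ {c ℓ₁ ℓ₂ s p : Level} (q : ℕ) → IsOddPrimePower q →
    (F : HeytingField c ℓ₁ ℓ₂) → HasSize (PG3.scalars F) q →
    (ζ : PG3.SymplecticPolarity F) →
    (S : Pred (PG3.Line F) s) → PG3.IsSpecialSpread F ζ S →
    (V₁ V₂ : Pred (PG3.Point F) p) →
    (bip : IsBipartition (PG3.flats F 1) V₁ V₂) →
    Inverse (subsetoid (PG3.flats F 1) V₁) (subsetoid (PG3.flats F 1) V₂) →
    PG3.SeparatesParts F ζ S V₁ V₂ →
    IsDivisibleDesignGraph (PG3.Γ′ F ζ bip)
    ((q ^ 2 + 1) * (q + 1))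
    ((q ^ 3 + q ^ 2 + 3 * q + 1) / 2)
    ((q ^ 3 ∸ q ^ 2 + 3 * q + 1) / 2)
    (q ^ 2 + q)
    2
    (((q ^ 2 + 1) * (q + 1)) / 2)
theorem2 q _ F sizeF ζ S special V₁ V₂ bip V₁↔V₂ separates =
  Partition.isDivisibleDesignGraph F sizeF ζ S special V₁ V₂ bip V₁↔V₂ separates
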